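{- Let $\mathbb K$ be a field of characteristic zero and let $\overline T(\mathcal{NC})$ be the unital tensor algebra over the linear span $\mathcal{NC}$ of all non-crossing partitions, with concatenation product. Equipped with the coproduct $\Delta$ described in the context, $\overline T(\mathcal{NC})$ is a connected graded, noncommutative and noncocommutative Hopf algebra.
   Context: For $n\ge 1$ let $[n]=\{1,\dots,n\}$. A partition of a finite set $S\subset\mathbb N$ into nonempty pairwise disjoint blocks is non-crossing if there are no $p_1<q_1<p_2<q_2$ in $S$ such that $p_1,p_2$ lie in one block and $q_1,q_2$ lie in a different block. $NC_n$ denotes the set of non-crossing partitions of $[n]$, and $\mathcal{NC}$ the $\mathbb K$-vector space with basis $\bigcup_{n\ge1}NC_n$; an element of $NC_n$ has degree $n$. For blocks $B,C$ of a non-crossing partition $L$, write $B<_L C$ iff $\inf C<m<\sup C$ for all $m\in B$ (i.e. $B$ is nested inside $C$). A decomposition $L=Q\sqcup U$ of the set of blocks of $L$ into two (possibly empty) subsets is called admissible if there is no block $B\in Q$ and block $C\in U$ with $B<_L C$. Given such an admissible decomposition of $L\in NC_n$, let $J_1,\dots,J_k$ be the maximal sets of consecutive integers contained in $[n]\setminus\bigcup_{B\in Q}B$, ordered from left to right; every block of $U$ is contained in a single $J_i$, and $J_i^{L,Q}$ denotes the non-crossing partition of $J_i$ formed by the blocks of $U$ contained in $J_i$. For a finite set $S\subset\mathbb N$ of cardinality $m$, the standardization $st$ is the unique increasing bijection $S\to[m]$; it is applied to partitions of $S$ by transporting blocks (so $st(Q)$ is a non-crossing partition of $[\,|\bigcup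 Q|\,]$). The unital tensor algebra $\overline T(\mathcal{NC})=\bigoplus_{k\ge0}\mathcal{NC}^{\otimes k}$ has elements written $L_1|\cdots|L_k$, product given by concatenation of such bar words, unit $\mathbf 1$ (the empty word), and grading by the sum of the degrees of the $L_i$. The coproduct is defined on $L\in NC_n$ by $$\Delta(L)=\sum_{L=Q\sqcup U\ \text{admissible}} st(Q)\otimes\big(st(J_1^{L,Q})|\cdots|st(J_k^{L,Q})\big),$$ with the conventions that $st(\emptyset)=\mathbf 1$ and that the empty bar word is $\mathbf 1$ (so $Q=\emptyset$ contributes $\mathbf 1\otimes L$ and $Q=L$ contributes $L\otimes\mathbf 1$); it is extended multiplicatively by $\Delta(L_1|\cdots|L_m)=\Delta(L_1)\cdots\Delta(L_m)$ (product in the tensor product algebra $\overline T(\mathcal{NC})\otimes\overline T(\mathcal{NC})$) and $\Delta(\mathbf 1)=\mathbf 1\otimes\mathbf 1$. -}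

module Defs where

open import Level using (_⊔_)
open import Algebra.Bundles using (CommutativeRing)
open import Data.Nat as ℕ using (ℕ; zero; suc; _<_; _≤_; _<ᵇ_; _≡ᵇ_; _≤ᵇ_; _⊓_)
  renaming (_+_ to _+ℕ_)
open import Data.Bool using (Bool; true; false; _∧_; not; if_then_else_)
open import Data.Bool.ListAction using (all; any)
open import Data.List as List
  using (List; []; _∷_; _++_; map; concat; concatMap; filterᵇ; length; foldr; upTo; lookup)
open import Data.List.Properties as LP using ()
open import Data.List.Relation.Unary.All using (All)
open import Data.List.Relation.Unary.AllPairs using (AllPairs)
open import Data.List.Relation.Binary.Permutation.Propositional using (_↭_)
open import Data.List.Membership.Propositional using (_∈_)
open import Data.Product using (Σ; ∃; _×_; _,_; proj₁; proj₂)
import Data.Product.Properties as PP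
open import Data.Fin using (Fin)
open import Relation.Binary.PropositionalEquality using (_≡_; _≢_)
open import Relation.Nullary using (¬_; does)
open import Relation.Binary using (DecidableEquality)

module _ {c ℓ} (K : CommutativeRing c ℓ) where
  open CommutativeRing K

  natK : ℕ → Carrier
  natK zero    = 0#
  natK (suc n) = 1# + natK n

  record IsFieldChar0 : Set (c ⊔ ℓ) where
    field
      1≉0     : ¬ (1# ≈ 0#)
      inverse : ∀ x → ¬ (x ≈ 0#) → Σ Carrier λ y → x * y ≈ 1#
      char0   : ∀ n → natK n ≈ 0# → n ≡ 0

-- Non-crossing partitions
-- A partition is represented canonically as a list of blocks, each block
-- a strictly increasing nonempty list, blocks ordered by their minima.

Block : Set
Block = List ℕ

Partition : Set
Partition = List Block

-- bar words L₁|⋯|Lₖ ; the empty word is the unit 𝟏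
Word : Set
Word = List Partition

minB : Block → ℕ
minB []      = 0
minB (x ∷ _) = x

range : ℕ → List ℕ
range n = map suc (upTo n)

record IsNCPartition (n : ℕ) (P : Partition) : Set where
  field
    n≥1           : 1 ≤ n
    nonemptyBlocks : All (λ B → B ≢ []) P
    sortedBlocks   : All (AllPairs _<_) P
    orderedBlocks  : AllPairs (λ B C → minB B < minB C) P
    covers         : concat P ↭ range n      -- blocks are disjoint and cover [n]
    nonCrossing    : ∀ (i j : Fin (length P)) → i ≢ j →
                     ∀ p₁ q₁ p₂ q₂ →
                     p₁ ∈ lookup P i → p₂ ∈ lookup P i →
                     q₁ ∈ lookup P j → q₂ ∈ lookup P j →
                     ¬ (p₁ < q₁ × q₁ < p₂ × p₂ < q₂)

IsNC : Partition → Set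
IsNC P = ∃ λ n → IsNCPartition n P

ValidWord : Word → Set
ValidWord w = All IsNC w

degP : Partition → ℕ
degP P = length (concat P)

degW : Word → ℕ
degW w = foldr (λ P n → degP P +ℕ n) 0 w

splits : {A : Set} → List A → List (List A × List A)
splits []       = ([] , []) ∷ []
splits (x ∷ xs) =
  concatMap (λ { (q , u) → ((x ∷ q) , u) ∷ (q , (x ∷ u)) ∷ [] }) (splits xs)

elemᵇ : ℕ → List ℕ → Bool
elemᵇ x = any (λ y → x ≡ᵇ y)

infB : Block → ℕ
infB []       = 0
infB (x ∷ xs) = foldr _⊓_ x xs

supB : Block → ℕ
supB []       = 0
supB (x ∷ xs) = foldr ℕ._⊔_ x xs

nestedᵇ : Block → Block → Bool
nestedᵇ B C = all (λ m → (infB C <ᵇ m) ∧ (m <ᵇ supB C)) B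

admissibleᵇ : Partition → Partition → Bool
admissibleᵇ Q U = not (any (λ B → any (λ C → nestedᵇ B C) U) Q)

rank : List ℕ → ℕ → ℕ
rank S x = length (filterᵇ (λ y → y ≤ᵇ x) S)

stRel : List ℕ → Partition → Partition
stRel S P = map (map (rank S)) P

st : Partition → Partition
st P = stRel (concat P) P

runs : List ℕ → List (List ℕ)
runs = foldr step []
  where
  step : ℕ → List (List ℕ) → List (List ℕ)
  step x []              = (x ∷ []) ∷ []
  step x ([] ∷ rs)       = (x ∷ []) ∷ rs
  step x ((y ∷ r) ∷ rs)  =
    if suc x ≡ᵇ y then (x ∷ y ∷ r) ∷ rs else (x ∷ []) ∷ (y ∷ r) ∷ rs

restrictSt : Partition → List ℕ → Partition
restrictSt U J = stRel J (filterᵇ (λ C → all (λ m → elemᵇ m J) C) U)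

-- st(Q), with st(∅) = 𝟏
leftWord : Partition → Word
leftWord []      = []
leftWord (B ∷ Q) = st (B ∷ Q) ∷ []

rightWord : ℕ → Partition → Partition → Word
rightWord n Q U =
  map (restrictSt U) (runs (filterᵇ (λ m → not (elemᵇ m (concat Q))) (range n)))

ΔTerms : Partition → List (Word × Word)
ΔTerms L =
  concatMap
    (λ { (Q , U) → if admissibleᵇ Q U
                     then (leftWord Q , rightWord (degP L) Q U) ∷ []
                     else [] })
    (splits L)

_≟W_ : DecidableEquality Word
_≟W_ = LP.≡-dec (LP.≡-dec (LP.≡-dec ℕ._≟_))

_≟W2_ : DecidableEquality (Word × Word)
_≟W2_ = PP.≡-dec _≟W_ _≟W_

_≟W3_ : DecidableEquality (Word × Word × Word)
_≟W3_ = PP.≡-dec _≟W_ _≟W2_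

-- Linear algebra over K: finite formal K-linear combinations of basis
-- elements, compared coefficientwise.

module Lin {c ℓ} (K : CommutativeRing c ℓ) where
  open CommutativeRing K renaming (Carrier to 𝕂)

  FSum : Set → Set c
  FSum B = List (𝕂 × B)

  coeff : {B : Set} → DecidableEquality B → FSum B → B → 𝕂
  coeff d []            b = 0#
  coeff d ((k , x) ∷ xs) b =
    if does (d x b) then k + coeff d xs b else coeff d xs b

  scale : {B : Set} → 𝕂 → FSum B → FSum B
  scale k = map (λ { (k' , x) → (k * k' , x) })

  T : Set c
  T = FSum Word

  T2 : Set c
  T2 = FSum (Word × Word)

  T3 : Set c
  T3 = FSum (Word × Word × Word)

  _≈T_ : T → T → Set ℓ
  x ≈T y = ∀ b → coeff _≟W_ x b ≈ coeff _≟W_ y b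

  _≈T2_ : T2 → T2 → Set ℓ
  x ≈T2 y = ∀ b → coeff _≟W2_ x b ≈ coeff _≟W2_ y b

  _≈T3_ : T3 → T3 → Set ℓ
  x ≈T3 y = ∀ b → coeff _≟W3_ x b ≈ coeff _≟W3_ y b

  ValidT : T → Set c
  ValidT x = All (λ p → ValidWord (proj₂ p)) x

  ValidT2 : T2 → Set c
  ValidT2 x = All (λ p → ValidWord (proj₁ (proj₂ p)) × ValidWord (proj₂ (proj₂ p))) x

  basis : Word → T
  basis w = (1# , w) ∷ []

  mulT : T → T → T
  mulT x y = concatMap (λ { (k , a) → map (λ { (k' , b) → (k * k' , a ++ b) }) y }) x

  oneT : T
  oneT = basis []

  mulT2 : T2 → T2 → T2
  mulT2 x y =
    concatMap (λ { (k , (a , b)) →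
      map (λ { (k' , (a' , b')) → (k * k' , (a ++ a' , b ++ b')) }) y }) x

  oneT2 : T2
  oneT2 = (1# , ([] , [])) ∷ []

  ΔL : Partition → T2
  ΔL L = map (λ t → (1# , t)) (ΔTerms L)

  Δw : Word → T2
  Δw []      = oneT2
  Δw (L ∷ w) = mulT2 (ΔL L) (Δw w)

  Δ : T → T2
  Δ x = concatMap (λ { (k , w) → scale k (Δw w) }) x

  εw : Word → 𝕂
  εw []      = 1#
  εw (_ ∷ _) = 0#

  ε : T → 𝕂
  ε x = foldr (λ { (k , w) r → k * εw w + r }) 0# x

  η : 𝕂 → T
  η k = (k , []) ∷ []

  Δ⊗id : T2 → T3
  Δ⊗id y = concatMap (λ { (k , (a , b)) →
             map (λ { (k' , (a₁ , a₂)) → (k * k' , (a₁ , a₂ , b)) }) (Δw a) }) y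

  id⊗Δ : T2 → T3
  id⊗Δ y = concatMap (λ { (k , (a , b)) →
             map (λ { (k' , (b₁ , b₂)) → (k * k' , (a , b₁ , b₂)) }) (Δw b) }) y

  -- (ε ⊗ id) and (id ⊗ ε), identifying K ⊗ T ≅ T ≅ T ⊗ K
  ε⊗id : T2 → T
  ε⊗id y = map (λ { (k , (a , b)) → (k * εw a , b) }) y

  id⊗ε : T2 → T
  id⊗ε y = map (λ { (k , (a , b)) → (k * εw b , a) }) y

  τ : T2 → T2
  τ y = map (λ { (k , (a , b)) → (k , (b , a)) }) y

  -- m ∘ (S ⊗ id) ∘ Δ  and  m ∘ (id ⊗ S) ∘ Δ, for S given on the basis
  -- and extended linearly
  convSid : (Word → T) → T → T
  convSid S x = concatMap (λ { (k , (a , b)) → scale k (mulT (S a) (basis b)) }) (Δ x)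

  convidS : (Word → T) → T → T
  convidS S x = concatMap (λ { (k , (a , b)) → scale k (mulT (basis a) (S b)) }) (Δ x)

  record IsConnectedGradedHopfAlgebra : Set (c ⊔ ℓ) where
    field
      mul-closed  : ∀ x y → ValidT x → ValidT y → ValidT (mulT x y)
      mul-assoc   : ∀ x y z → ValidT x → ValidT y → ValidT z →
                    mulT (mulT x y) z ≈T mulT x (mulT y z)
      mul-unitˡ   : ∀ x → ValidT x → mulT oneT x ≈T x
      mul-unitʳ   : ∀ x → ValidT x → mulT x oneT ≈T x
      Δ-closed    : ∀ x → ValidT x → ValidT2 (Δ x)
      coassoc     : ∀ x → ValidT x → Δ⊗id (Δ x) ≈T3 id⊗Δ (Δ x)
      counitˡ     : ∀ x → ValidT x → ε⊗id (Δ x) ≈T x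
      counitʳ     : ∀ x → ValidT x → id⊗ε (Δ x) ≈T x
      Δ-mul       : ∀ x y → ValidT x → ValidT y → Δ (mulT x y) ≈T2 mulT2 (Δ x) (Δ y)
      Δ-unit      : Δ oneT ≈T2 oneT2
      ε-mul       : ∀ x y → ValidT x → ValidT y → ε (mulT x y) ≈ ε x * ε y
      ε-unit      : ε oneT ≈ 1#
      antipode    : Σ (Word → T) λ S →
                      (∀ w → ValidWord w → ValidT (S w)) ×
                      (∀ x → ValidT x → convSid S x ≈T η (ε x)) ×
                      (∀ x → ValidT x → convidS S x ≈T η (ε x))
      deg-mul     : ∀ u v → degW (u ++ v) ≡ degW u +ℕ degW v
      deg-Δ       : ∀ w → ValidWord w →
                    All (λ t → degW (proj₁ (proj₂ t)) +ℕ degW (proj₂ (proj₂ t)) ≡ degW w) (Δw w)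
      connected   : ∀ w → ValidWord w → degW w ≡ 0 → w ≡ []

  NonCommutative : Set (c ⊔ ℓ)
  NonCommutative = Σ T λ x → Σ T λ y →
    ValidT x × ValidT y × ¬ (mulT x y ≈T mulT y x)

  NonCocommutative : Set (c ⊔ ℓ)
  NonCocommutative = Σ T λ x → ValidT x × ¬ (Δ x ≈T2 τ (Δ x))

{-# OPTIONS --safe #-}
module Submission where

-- Without standardization, the coproduct of a non-crossing partition P of a finite set S is a sum over the admissible
-- splittings P = Q ⊔ U, with Q on the left and, on the right, the restrictions of U to the pieces into which the elements
-- of Q cut S: non-crossing forces every block of U into a single piece. Both iterated coproducts are therefore sums over
-- the splittings P = Q₁ ⊔ Q₂ ⊔ U in which no block is nested in a block of a later part, and the words agree because
-- cutting S by Q₁ and then the pieces by Q₂ is the same as cutting S by Q₁ ⊔ Q₂. The antipode exists because the bialgebra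
-- is connected and graded.
--
-- Formal sums are compared by pairing them with arbitrary functions on the basis, so that all the tensor identities become
-- identities between finite iterated sums in K.

open import Defs
open import Algebra.Bundles using (CommutativeRing)
import Algebra.Properties.CommutativeSemigroup as CommutativeSemigroupProperties
import Algebra.Properties.Ring as RingProperties
open import Data.Bool as Bool using (Bool; true; false; _∧_; not; if_then_else_)
open import Data.Bool.ListAction using (all; any)
open import Data.Bool.Properties using (T-≡)
open import Data.Empty using (⊥; ⊥-elim)
open import Data.Fin using (Fin; zero; suc)
open import Data.List using (List; []; _∷_; _++_; map; concat; concatMap; filterᵇ; length; foldr; upTo; applyUpTo; lookup)
open import Data.List.Properties
open import Data.List.Membership.Propositional using (_∈_; _∉_)
open import Data.List.Membership.Propositional.Properties
open import Data.List.Membership.Propositional.Properties.WithK using (unique∧set⇒bag)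
open import Data.List.Relation.Binary.BagAndSetEquality using (∼bag⇒↭)
open import Data.List.Relation.Binary.Permutation.Propositional as Perm using (_↭_; ↭-sym)
open import Data.List.Relation.Binary.Permutation.Propositional.Properties
  using (filter-↭; ↭-length; ∈-resp-↭; All-resp-↭)
open import Data.List.Relation.Binary.Sublist.Propositional as Sub using () renaming (_⊆_ to _⊑_)
open import Data.List.Relation.Binary.Sublist.Propositional.Properties as SubP using (All-resp-⊆)
open import Data.List.Relation.Binary.Subset.Propositional using (_⊆_)
open import Data.List.Relation.Ternary.Interleaving.Propositional as Inter using (Interleaving; []; consˡ; consʳ)
open import Data.List.Relation.Unary.All as All using (All; []; _∷_)
import Data.List.Relation.Unary.All.Properties as AllP
open import Data.List.Relation.Unary.AllPairs as AllPairs using (AllPairs; []; _∷_)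
import Data.List.Relation.Unary.AllPairs.Properties as AllPairsP
open import Data.List.Relation.Unary.Any using (here; there; index)
import Data.List.Relation.Unary.Any.Properties as AnyP
open import Data.List.Relation.Unary.Unique.Propositional using (Unique)
open import Data.Nat using (ℕ; zero; suc; _<_; _≤_; _<ᵇ_; _≡ᵇ_; _≤ᵇ_; _⊓_; _⊔_; z≤n; s≤s) renaming (_+_ to _+ℕ_)
open import Data.Nat.Properties as ℕP using (≤-refl; ≤-trans; ≤-<-trans; <-≤-trans; <-cmp; <-irrefl; <-asym; <⇒≱; <⇒≤; <⇒≢; ≮⇒≥; ≤⇒≤ᵇ; ≤ᵇ⇒≤; <⇒<ᵇ; <ᵇ⇒<; ≡ᵇ⇒≡; ≡⇒≡ᵇ; m⊓n≤m; m⊓n≤n; m≤m⊔n; m≤n⊔m; ⊓-sel; ⊔-sel; m≤n⇒m≤1+n)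
open import Data.Product using (∃; _×_; _,_; proj₁; proj₂)
open import Data.Sum using (_⊎_; inj₁; inj₂; [_,_]′)
open import Function using (_∘_; id; mk⇔; Equivalence)
open import Relation.Binary using (DecidableEquality)
open import Relation.Binary.Definitions using (tri<; tri≈; tri>)
open import Relation.Binary.PropositionalEquality
  using (_≡_; _≢_; refl; sym; trans; cong; cong₂; subst; subst₂)
open import Relation.Nullary using (¬_; does)

-- Standardization is what makes coassociativity awkward: each letter of the first coproduct is
-- renumbered before it is cut again. Since `leftWord` depends only on the relative order of the
-- elements, `E-leftWord` expands the coproduct of a standardized partition over splittings of the
-- original blocks on the original set. The right-hand factor raises a second difficulty. It is a
-- word, so its coproduct is a product of sums, one for each piece, whereas three-way splittings ask
-- for one sum over the splittings of all inner blocks. The two agree because blocks in different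
-- pieces never nest, so admissibility can be tested piece by piece, and because blocks are listed
-- by increasing minima, so the blocks of successive pieces are successive segments of the list.
-- `Decomp` records both facts. Coassociativity and the counit laws are established on words of
-- non-crossing partitions; every term of a coproduct therefore carries its validity, together with
-- its degree, in `Good`, and the antipode argument works with valid words throughout.

private variable
  A B : Set

-- Booleans and lists

bool-ext : ∀ {a b} → (a ≡ true → b ≡ true) → (b ≡ true → a ≡ true) → a ≡ b
bool-ext {true}          f g = sym (f refl)
bool-ext {false} {true}  f g = g refl
bool-ext {false} {false} f g = refl

true≢false : ∀ {b} → b ≡ true → b ≡ false → ⊥
true≢false refl ()

not-true⁺ : ∀ {b} → (b ≡ true → ⊥) → not b ≡ true
not-true⁺ {true}  f = ⊥-elim (f refl)
not-true⁺ {false} f = refl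

not-true⁻ : ∀ {b} → not b ≡ true → b ≡ false
not-true⁻ {false} _ = refl

∧-true⁻ : ∀ {a b} → a ∧ b ≡ true → a ≡ true × b ≡ true
∧-true⁻ {true} e = refl , e

∧-true⁺ : ∀ {a b} → a ≡ true → b ≡ true → a ∧ b ≡ true
∧-true⁺ refl e = e

T⇒true : ∀ {b} → Bool.T b → b ≡ true
T⇒true = Equivalence.to T-≡

true⇒T : ∀ {b} → b ≡ true → Bool.T b
true⇒T = Equivalence.from T-≡

all-true⁺ : ∀ {p : A → Bool} xs → (∀ {x} → x ∈ xs → p x ≡ true) → all p xs ≡ true
all-true⁺ []       f = refl
all-true⁺ (x ∷ xs) f = ∧-true⁺ (f (here refl)) (all-true⁺ xs (f ∘ there))

all-true⁻ : ∀ {p : A → Bool} {xs x} → all p xs ≡ true → x ∈ xs → p x ≡ true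
all-true⁻ e (here refl) = proj₁ (∧-true⁻ e)
all-true⁻ e (there x∈)  = all-true⁻ (proj₂ (∧-true⁻ e)) x∈

any-true⁺ : ∀ {p : A → Bool} {xs x} → x ∈ xs → p x ≡ true → any p xs ≡ true
any-true⁺             (here refl) e rewrite e = refl
any-true⁺ {p = p} {y ∷ _} (there x∈) e with p y
... | true  = refl
... | false = any-true⁺ x∈ e

any-true⁻ : ∀ {p : A → Bool} xs → any p xs ≡ true → ∃ λ x → x ∈ xs × p x ≡ true
any-true⁻ {p = p} (y ∷ xs) e with p y in eq
... | true  = y , here refl , eq
... | false with x , x∈ , px ← any-true⁻ xs e = x , there x∈ , px

elem⁺ : ∀ {x xs} → x ∈ xs → elemᵇ x xs ≡ true
elem⁺ {x} x∈ = any-true⁺ x∈ (T⇒true (≡⇒≡ᵇ x x refl))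

elem⁻ : ∀ {x} xs → elemᵇ x xs ≡ true → x ∈ xs
elem⁻ {x} xs e with y , y∈ , x≡ᵇy ← any-true⁻ xs e
  rewrite ≡ᵇ⇒≡ x y (true⇒T x≡ᵇy) = y∈

∉⇒elem-false : ∀ {x xs} → x ∉ xs → elemᵇ x xs ≡ false
∉⇒elem-false {xs = xs} x∉ = not-true⁻ (not-true⁺ (x∉ ∘ elem⁻ xs))

∈-filterᵇ⁺ : ∀ {p : A → Bool} {xs x} → x ∈ xs → p x ≡ true → x ∈ filterᵇ p xs
∈-filterᵇ⁺ x∈ px = ∈-filter⁺ _ x∈ (true⇒T px)

∈-filterᵇ⁻ : ∀ (p : A → Bool) xs {x} → x ∈ filterᵇ p xs → x ∈ xs × p x ≡ true
∈-filterᵇ⁻ p xs x∈ with y∈ , px ← ∈-filter⁻ _ x∈ = y∈ , T⇒true px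

filterᵇ-cong : ∀ {p q : A → Bool} xs → (∀ {x} → x ∈ xs → p x ≡ q x) → filterᵇ p xs ≡ filterᵇ q xs
filterᵇ-cong []       f = refl
filterᵇ-cong {p = p} {q} (x ∷ xs) f rewrite f (here refl) with q x
... | true  = cong (x ∷_) (filterᵇ-cong xs (f ∘ there))
... | false = filterᵇ-cong xs (f ∘ there)

filterᵇ-map : ∀ (p : B → Bool) (f : A → B) xs → filterᵇ p (map f xs) ≡ map f (filterᵇ (p ∘ f) xs)
filterᵇ-map p f []       = refl
filterᵇ-map p f (x ∷ xs) with p (f x)
... | true  = cong (f x ∷_) (filterᵇ-map p f xs)
... | false = filterᵇ-map p f xs

filterᵇ-++ : ∀ (p : A → Bool) xs ys → filterᵇ p (xs ++ ys) ≡ filterᵇ p xs ++ filterᵇ p ys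
filterᵇ-++ p []       ys = refl
filterᵇ-++ p (x ∷ xs) ys with p x
... | true  = cong (x ∷_) (filterᵇ-++ p xs ys)
... | false = filterᵇ-++ p xs ys

filterᵇ-all : ∀ {p : A → Bool} xs → (∀ {x} → x ∈ xs → p x ≡ true) → filterᵇ p xs ≡ xs
filterᵇ-all []       f = refl
filterᵇ-all (x ∷ xs) f rewrite f (here refl) = cong (x ∷_) (filterᵇ-all xs (f ∘ there))

filterᵇ-none : ∀ {p : A → Bool} xs → (∀ {x} → x ∈ xs → p x ≡ false) → filterᵇ p xs ≡ []
filterᵇ-none []       f = refl
filterᵇ-none (x ∷ xs) f rewrite f (here refl) = filterᵇ-none xs (f ∘ there)

filterᵇ-absorb : ∀ {p q : A → Bool} xs → (∀ {x} → x ∈ xs → q x ≡ true → p x ≡ true) →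
                 filterᵇ q (filterᵇ p xs) ≡ filterᵇ q xs
filterᵇ-absorb []       f = refl
filterᵇ-absorb {p = p} {q} (x ∷ xs) f with p x in px | q x in qx
... | true  | true  rewrite qx = cong (x ∷_) (filterᵇ-absorb xs (f ∘ there))
... | true  | false rewrite qx = filterᵇ-absorb xs (f ∘ there)
... | false | true  = ⊥-elim (true≢false (f (here refl) qx) px)
... | false | false = filterᵇ-absorb xs (f ∘ there)

filterᵇ-⊑ : ∀ (p : A → Bool) xs → filterᵇ p xs ⊑ xs
filterᵇ-⊑ p xs = SubP.filter-⊆ _ xs

length-filterᵇ-not : ∀ (p : A → Bool) xs →
                     length (filterᵇ p xs) +ℕ length (filterᵇ (not ∘ p) xs) ≡ length xs
length-filterᵇ-not p []       = refl
length-filterᵇ-not p (x ∷ xs) with p x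
... | true  = cong suc (length-filterᵇ-not p xs)
... | false = trans (ℕP.+-suc _ _) (cong suc (length-filterᵇ-not p xs))

map-cong-∈ : ∀ {f g : A → B} xs → (∀ {x} → x ∈ xs → f x ≡ g x) → map f xs ≡ map g xs
map-cong-∈ xs h = map-cong-local (All.tabulate h)

concatMap-cong-∈ : ∀ {f g : A → List B} xs → (∀ {x} → x ∈ xs → f x ≡ g x) →
                   concatMap f xs ≡ concatMap g xs
concatMap-cong-∈ xs h = cong concat (map-cong-∈ xs h)

AllPairs-map-∈ : ∀ {R : A → A → Set} {R′ : B → B → Set} {f : A → B} {xs} →
                 (∀ {x y} → x ∈ xs → y ∈ xs → R x y → R′ (f x) (f y)) →
                 AllPairs R xs → AllPairs R′ (map f xs)
AllPairs-map-∈ h []         = []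
AllPairs-map-∈ h (rs ∷ rss) =
  AllP.map⁺ (All.tabulate λ y∈ → h (here refl) (there y∈) (All.lookup rs y∈)) ∷
  AllPairs-map-∈ (λ x∈ y∈ → h (there x∈) (there y∈)) rss

AllPairs-++⁻ : ∀ {R : A → A → Set} xs {ys} → AllPairs R (xs ++ ys) →
               AllPairs R xs × AllPairs R ys × (∀ {x y} → x ∈ xs → y ∈ ys → R x y)
AllPairs-++⁻ []       rs        = [] , rs , λ ()
AllPairs-++⁻ (x ∷ xs) (r ∷ rs) with xs! , ys! , h ← AllPairs-++⁻ xs rs =
  AllP.++⁻ˡ xs r ∷ xs! , ys! ,
  λ { (here refl) y∈ → All.lookup (AllP.++⁻ʳ xs r) y∈ ; (there x∈) y∈ → h x∈ y∈ }

AllPairs-concat⁻ : ∀ {R : A → A → Set} xss → AllPairs R (concat xss) →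
                   All (AllPairs R) xss ×
                   AllPairs (λ xs ys → ∀ {x y} → x ∈ xs → y ∈ ys → R x y) xss
AllPairs-concat⁻ []         _  = [] , []
AllPairs-concat⁻ (xs ∷ xss) rs with xs! , rest! , h ← AllPairs-++⁻ xs rs
  with a , b ← AllPairs-concat⁻ xss rest! =
  xs! ∷ a , All.tabulate (λ ys∈ x∈ y∈ → h x∈ (∈-concat⁺′ y∈ ys∈)) ∷ b

unique-↭ : {xs ys : List A} → Unique xs → Unique ys → xs ⊆ ys → ys ⊆ xs → xs ↭ ys
unique-↭ xs! ys! f g = ∼bag⇒↭ (unique∧set⇒bag xs! ys! (mk⇔ f g))

sorted⇒unique : ∀ {xs} → AllPairs _<_ xs → Unique xs
sorted⇒unique = AllPairs.map <⇒≢

AllPairs-resp-⊑ : ∀ {R : A → A → Set} {xs ys} → xs ⊑ ys → AllPairs R ys → AllPairs R xs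
AllPairs-resp-⊑ Sub.[]         rs       = []
AllPairs-resp-⊑ (_ Sub.∷ʳ s)   (_ ∷ rs) = AllPairs-resp-⊑ s rs
AllPairs-resp-⊑ (refl Sub.∷ s) (r ∷ rs) = All-resp-⊆ s r ∷ AllPairs-resp-⊑ s rs

concat-⊑ : {P Q : List (List A)} → Q ⊑ P → concat Q ⊑ concat P
concat-⊑ Sub.[]         = Sub.[]
concat-⊑ (xs Sub.∷ʳ s)  = SubP.++⁺ˡ xs (concat-⊑ s)
concat-⊑ (refl Sub.∷ s) = SubP.++⁺ Sub.⊆-refl (concat-⊑ s)

-- Interleavings

private variable
  Q U P V Q₁ Q₂ : Partition

interleaving-⊑ˡ : {xs ys zs : List A} → Interleaving xs ys zs → xs ⊑ zs
interleaving-⊑ˡ []        = Sub.[]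
interleaving-⊑ˡ (consˡ i) = refl Sub.∷ interleaving-⊑ˡ i
interleaving-⊑ˡ (consʳ i) = _ Sub.∷ʳ interleaving-⊑ˡ i

interleaving-⊑ʳ : {xs ys zs : List A} → Interleaving xs ys zs → ys ⊑ zs
interleaving-⊑ʳ i = interleaving-⊑ˡ (Inter.swap i)

interleaving-∈ : {xs ys zs : List A} → Interleaving xs ys zs → ∀ {x} → x ∈ zs → x ∈ xs ⊎ x ∈ ys
interleaving-∈ {xs = xs} i x∈ = ∈-++⁻ xs (∈-resp-↭ (Inter.toPermutation i) x∈)

-- Elements taken from the two parts occupy different positions of the whole list, and which
-- position comes first is not known; hence the disjunction.
interleaving-related : ∀ {R : A → A → Set} {xs ys zs} → Interleaving xs ys zs → AllPairs R zs →
                       ∀ {x y} → x ∈ xs → y ∈ ys → R x y ⊎ R y x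
interleaving-related (consˡ i) (r ∷ rs) (here refl) y∈ =
  inj₁ (All.lookup r (Sub.lookup (interleaving-⊑ʳ i) y∈))
interleaving-related (consˡ i) (r ∷ rs) (there x∈)  y∈ = interleaving-related i rs x∈ y∈
interleaving-related (consʳ i) (r ∷ rs) x∈ (here refl) =
  inj₂ (All.lookup r (Sub.lookup (interleaving-⊑ˡ i) x∈))
interleaving-related (consʳ i) (r ∷ rs) x∈ (there y∈) = interleaving-related i rs x∈ y∈

interleaving-map : ∀ (f : A → B) {xs ys zs} → Interleaving xs ys zs → Interleaving (map f xs) (map f ys) (map f zs)
interleaving-map f []        = []
interleaving-map f (consˡ i) = consˡ (interleaving-map f i)
interleaving-map f (consʳ i) = consʳ (interleaving-map f i)

-- Nesting and admissibility

∈-foldr-⊓ : ∀ x xs → foldr _⊓_ x xs ∈ x ∷ xs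
∈-foldr-⊓ x []       = here refl
∈-foldr-⊓ x (y ∷ xs) with ⊓-sel y (foldr _⊓_ x xs)
... | inj₁ e rewrite e = there (here refl)
... | inj₂ e rewrite e with ∈-foldr-⊓ x xs
...   | here e′  = here e′
...   | there m∈ = there (there m∈)

∈-foldr-⊔ : ∀ x xs → foldr _⊔_ x xs ∈ x ∷ xs
∈-foldr-⊔ x []       = here refl
∈-foldr-⊔ x (y ∷ xs) with ⊔-sel y (foldr _⊔_ x xs)
... | inj₁ e rewrite e = there (here refl)
... | inj₂ e rewrite e with ∈-foldr-⊔ x xs
...   | here e′  = here e′
...   | there m∈ = there (there m∈)

foldr-⊓-≤ : ∀ x xs {y} → y ∈ x ∷ xs → foldr _⊓_ x xs ≤ y
foldr-⊓-≤ x []       (here refl)         = ≤-refl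
foldr-⊓-≤ x (z ∷ xs) (there (here refl)) = m⊓n≤m z _
foldr-⊓-≤ x (z ∷ xs) (here refl)         = ≤-trans (m⊓n≤n z _) (foldr-⊓-≤ x xs (here refl))
foldr-⊓-≤ x (z ∷ xs) (there (there y∈))  = ≤-trans (m⊓n≤n z _) (foldr-⊓-≤ x xs (there y∈))

≤-foldr-⊔ : ∀ x xs {y} → y ∈ x ∷ xs → y ≤ foldr _⊔_ x xs
≤-foldr-⊔ x []       (here refl)         = ≤-refl
≤-foldr-⊔ x (z ∷ xs) (there (here refl)) = m≤m⊔n z _
≤-foldr-⊔ x (z ∷ xs) (here refl)         = ≤-trans (≤-foldr-⊔ x xs (here refl)) (m≤n⊔m z _)
≤-foldr-⊔ x (z ∷ xs) (there (there y∈))  = ≤-trans (≤-foldr-⊔ x xs (there y∈)) (m≤n⊔m z _)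

-- This is `inf C < m < sup C` with the extrema replaced by witnesses, which increasing maps carry
-- along directly. It also excludes an empty `C`, in agreement with the default value 0 of both
-- `infB` and `supB`.
Straddles : Block → ℕ → Set
Straddles C m = (∃ λ c → c ∈ C × c < m) × (∃ λ c → c ∈ C × m < c)

nested⁻ : ∀ {B} C → nestedᵇ B C ≡ true → ∀ {m} → m ∈ B → Straddles C m
nested⁻ []      e {m} m∈ with () ← proj₂ (∧-true⁻ {0 <ᵇ m} {m <ᵇ 0} (all-true⁻ e m∈))
nested⁻ (c ∷ C) e m∈ with e₁ , e₂ ← ∧-true⁻ (all-true⁻ e m∈) =
  (_ , ∈-foldr-⊓ c C , <ᵇ⇒< _ _ (true⇒T e₁)) , (_ , ∈-foldr-⊔ c C , <ᵇ⇒< _ _ (true⇒T e₂))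

nested⁺ : ∀ B C → (∀ {m} → m ∈ B → Straddles C m) → nestedᵇ B C ≡ true
nested⁺ B []      h = all-true⁺ B λ m∈ → case (h m∈)
  where
  case : ∀ {m} {b : Bool} → Straddles [] m → b ≡ true
  case ((_ , () , _) , _)
nested⁺ B (c ∷ C) h = all-true⁺ B λ m∈ → case (h m∈)
  where
  case : ∀ {m} → Straddles (c ∷ C) m → (infB (c ∷ C) <ᵇ m) ∧ (m <ᵇ supB (c ∷ C)) ≡ true
  case ((a , a∈ , a<m) , (b , b∈ , m<b)) =
    ∧-true⁺ (T⇒true (<⇒<ᵇ (≤-<-trans (foldr-⊓-≤ c C a∈) a<m)))
            (T⇒true (<⇒<ᵇ (<-≤-trans m<b (≤-foldr-⊔ c C b∈))))

Adm : Partition → Partition → Set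
Adm Q U = ∀ {B C} → B ∈ Q → C ∈ U → nestedᵇ B C ≡ false

adm⁻ : ∀ Q U → admissibleᵇ Q U ≡ true → Adm Q U
adm⁻ Q U e {B} {C} B∈ C∈ with nestedᵇ B C in eq
... | false = refl
... | true  = ⊥-elim (true≢false (any-true⁺ B∈ (any-true⁺ C∈ eq)) (not-true⁻ e))

adm⁺ : ∀ Q U → Adm Q U → admissibleᵇ Q U ≡ true
adm⁺ Q U h = not-true⁺ λ e → contra (any-true⁻ Q e)
  where
  contra : (∃ λ B → B ∈ Q × any (λ C → nestedᵇ B C) U ≡ true) → ⊥
  contra (B , B∈ , e) with C , C∈ , eq ← any-true⁻ U e = true≢false eq (h B∈ C∈)

-- Non-crossing partitions of an arbitrary finite set, given as a sorted list

record NCOn (S : List ℕ) (P : Partition) : Set where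
  field
    sorted      : AllPairs _<_ S
    nonempty    : All (λ B → B ≢ []) P
    sortedBs    : All (AllPairs _<_) P
    orderedBs   : AllPairs (λ B C → minB B < minB C) P
    unique      : Unique (concat P)
    covers      : S ⊆ concat P
    within      : concat P ⊆ S
    nonCrossing : ∀ {B C} → B ∈ P → C ∈ P → B ≢ C →
                  ∀ {p₁ q₁ p₂ q₂} → p₁ ∈ B → p₂ ∈ B → q₁ ∈ C → q₂ ∈ C →
                  p₁ < q₁ → q₁ < p₂ → p₂ < q₂ → ⊥

  perm : concat P ↭ S
  perm = unique-↭ unique (sorted⇒unique sorted) within covers

  block-⊆ : ∀ {B} → B ∈ P → B ⊆ S
  block-⊆ B∈ x∈ = within (∈-concat⁺′ x∈ B∈)

open NCOn

-- The conditions on the blocks pass to every sublist. `nonCrossing` does so without renumbering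
-- because it speaks of distinct blocks rather than of distinct positions; only the support has to
-- be supplied anew.
subNC : ∀ {S S′ P P′} → NCOn S P → P′ ⊑ P → AllPairs _<_ S′ → S′ ⊆ concat P′ → concat P′ ⊆ S′ →
        NCOn S′ P′
subNC nc s S′! c w = record
  { sorted = S′! ; nonempty = All-resp-⊆ s (nonempty nc) ; sortedBs = All-resp-⊆ s (sortedBs nc)
  ; orderedBs = AllPairs-resp-⊑ s (orderedBs nc) ; unique = AllPairs-resp-⊑ (concat-⊑ s) (unique nc)
  ; covers = c ; within = w
  ; nonCrossing = λ B∈ C∈ → nonCrossing nc (Sub.lookup s B∈) (Sub.lookup s C∈) }

NCOn-[] : ∀ {P} → NCOn [] P → P ≡ []
NCOn-[] {[]}          nc = refl
NCOn-[] {[] ∷ P}      nc = ⊥-elim (All.head (nonempty nc) refl)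
NCOn-[] {(x ∷ B) ∷ P} nc with () ← within nc (here refl)

unique-concat-block : {P : List (List A)} → Unique (concat P) →
                      ∀ {B C x} → B ∈ P → C ∈ P → x ∈ B → x ∈ C → B ≡ C
unique-concat-block {P = X ∷ P} u B∈ C∈ x∈B x∈C with _ , uP , dis ← AllPairs-++⁻ X u with B∈ | C∈
... | here refl | here refl = refl
... | here refl | there C∈′ = ⊥-elim (dis x∈B (∈-concat⁺′ x∈C C∈′) refl)
... | there B∈′ | here refl = ⊥-elim (dis x∈C (∈-concat⁺′ x∈B B∈′) refl)
... | there B∈′ | there C∈′ = unique-concat-block uP B∈′ C∈′ x∈B x∈C

-- A block common to both parts would occur at two positions of `P`, and its minimum would be
-- smaller than itself.
interleaving-≢ : ∀ {S} → NCOn S P → Interleaving Q U P → ∀ {B C} → B ∈ Q → C ∈ U → B ≢ C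
interleaving-≢ nc i {B} B∈ C∈ refl =
  [ <-irrefl {minB B} refl , <-irrefl {minB B} refl ]′ (interleaving-related i (orderedBs nc) B∈ C∈)

interleaving-disjoint : ∀ {S} → NCOn S P → Interleaving Q U P → ∀ {x} → x ∈ concat Q → x ∈ concat U → ⊥
interleaving-disjoint {Q = Q} {U} nc i x∈Q x∈U
  with B , x∈B , B∈ ← ∈-concat⁻′ Q x∈Q | C , x∈C , C∈ ← ∈-concat⁻′ U x∈U =
  interleaving-≢ nc i B∈ C∈ (unique-concat-block (unique nc)
    (Sub.lookup (interleaving-⊑ˡ i) B∈) (Sub.lookup (interleaving-⊑ʳ i) C∈) x∈B x∈C)

interleaving-concat : Interleaving Q U P → ∀ {x} → x ∈ concat P → x ∈ concat Q ⊎ x ∈ concat U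
interleaving-concat {P = P} i x∈ with B , x∈B , B∈ ← ∈-concat⁻′ P x∈ with interleaving-∈ i B∈
... | inj₁ B∈Q = inj₁ (∈-concat⁺′ x∈B B∈Q)
... | inj₂ B∈U = inj₂ (∈-concat⁺′ x∈B B∈U)

interleaving-NCˡ : ∀ {S} → NCOn S P → Interleaving Q U P →
                   NCOn (filterᵇ (λ m → elemᵇ m (concat Q)) S) Q
interleaving-NCˡ {Q = Q} {S = S} nc i = subNC nc (interleaving-⊑ˡ i) (AllPairsP.filter⁺ _ (sorted nc))
  (λ x∈ → elem⁻ (concat Q) (proj₂ (∈-filterᵇ⁻ _ S x∈)))
  (λ x∈ → ∈-filterᵇ⁺ (within nc (Sub.lookup (concat-⊑ (interleaving-⊑ˡ i)) x∈)) (elem⁺ x∈))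

-- Cutting a list at the elements satisfying a predicate, keeping empty pieces

first : (ℕ → Bool) → List ℕ → List ℕ
first q []       = []
first q (x ∷ xs) = if q x then [] else x ∷ first q xs

rest : (ℕ → Bool) → List ℕ → List (List ℕ)
rest q []       = []
rest q (x ∷ xs) = if q x then first q xs ∷ rest q xs else rest q xs

pieces : (ℕ → Bool) → List ℕ → List (List ℕ)
pieces q S = first q S ∷ rest q S

private variable
  q q′ p : ℕ → Bool

concat-pieces : ∀ S → concat (pieces q S) ≡ filterᵇ (not ∘ q) S
concat-pieces []       = refl
concat-pieces {q} (x ∷ S) with q x
... | true  = concat-pieces S
... | false = cong (x ∷_) (concat-pieces S)

-- Every separator survives the filter, so no cut is lost. A piece may become empty, which is
-- harmless only because empty pieces are kept.
pieces-filter : ∀ S → (∀ {x} → x ∈ S → q x ≡ true → p x ≡ true) →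
                pieces q (filterᵇ p S) ≡ map (filterᵇ p) (pieces q S)
pieces-filter S h = cong₂ _∷_ (f S h) (r S h)
  where
  f : ∀ S → (∀ {x} → x ∈ S → q x ≡ true → p x ≡ true) → first q (filterᵇ p S) ≡ filterᵇ p (first q S)
  f []      h = refl
  f {q} {p} (x ∷ S) h with q x in qx | p x in px
  ... | true  | true  rewrite qx = refl
  ... | true  | false = ⊥-elim (true≢false (h (here refl) qx) px)
  ... | false | true  rewrite qx | px = cong (x ∷_) (f S (h ∘ there))
  ... | false | false rewrite px = f S (h ∘ there)
  r : ∀ S → (∀ {x} → x ∈ S → q x ≡ true → p x ≡ true) → rest q (filterᵇ p S) ≡ map (filterᵇ p) (rest q S)
  r []      h = refl
  r {q} {p} (x ∷ S) h with q x in qx | p x in px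
  ... | true  | true  rewrite qx = cong₂ _∷_ (f S (h ∘ there)) (r S (h ∘ there))
  ... | true  | false = ⊥-elim (true≢false (h (here refl) qx) px)
  ... | false | true  rewrite qx = r S (h ∘ there)
  ... | false | false = r S (h ∘ there)

-- A separator for `q` is also one for `p`, so no `p`-piece reaches across a `q`-cut.
pieces-refine : ∀ S → (∀ {x} → x ∈ S → q x ≡ true → p x ≡ true) →
                pieces p S ≡ concatMap (pieces p) (pieces q S)
pieces-refine S h = cong₂ _∷_ (f S h) (r S h)
  where
  f : ∀ S → (∀ {x} → x ∈ S → q x ≡ true → p x ≡ true) → first p S ≡ first p (first q S)
  f []      h = refl
  f {q} {p} (x ∷ S) h with q x in qx | p x in px
  ... | true  | true  = refl
  ... | true  | false = ⊥-elim (true≢false (h (here refl) qx) px)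
  ... | false | true  rewrite px = refl
  ... | false | false rewrite px = cong (x ∷_) (f S (h ∘ there))
  r : ∀ S → (∀ {x} → x ∈ S → q x ≡ true → p x ≡ true) →
      rest p S ≡ rest p (first q S) ++ concatMap (pieces p) (rest q S)
  r []      h = refl
  r {q} {p} (x ∷ S) h with q x in qx | p x in px
  ... | true  | true  = cong₂ _∷_ (f S (h ∘ there)) (r S (h ∘ there))
  ... | true  | false = ⊥-elim (true≢false (h (here refl) qx) px)
  ... | false | true  rewrite px = cong₂ _∷_ (f S (h ∘ there)) (r S (h ∘ there))
  ... | false | false rewrite px = r S (h ∘ there)

pieces-map : ∀ {f : ℕ → ℕ} S → (∀ {x} → x ∈ S → q′ (f x) ≡ q x) →
             pieces q′ (map f S) ≡ map (map f) (pieces q S)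
pieces-map {q′} {q} {f} S h = cong₂ _∷_ (fs S h) (r S h)
  where
  fs : ∀ S → (∀ {x} → x ∈ S → q′ (f x) ≡ q x) → first q′ (map f S) ≡ map f (first q S)
  fs []      h = refl
  fs (x ∷ S) h rewrite h (here refl) with q x
  ... | true  = refl
  ... | false = cong (f x ∷_) (fs S (h ∘ there))
  r : ∀ S → (∀ {x} → x ∈ S → q′ (f x) ≡ q x) → rest q′ (map f S) ≡ map (map f) (rest q S)
  r []      h = refl
  r (x ∷ S) h rewrite h (here refl) with q x
  ... | true  = cong₂ _∷_ (fs S (h ∘ there)) (r S (h ∘ there))
  ... | false = r S (h ∘ there)

pieces-cong : ∀ S → (∀ {x} → x ∈ S → q x ≡ q′ x) → pieces q S ≡ pieces q′ S
pieces-cong S h = trans (cong (pieces _) (sym (map-id S)))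
  (trans (pieces-map {f = id} S h) (trans (map-cong map-id (pieces _ S)) (map-id _)))

∈-pieces⁻ : ∀ {S J x} → J ∈ pieces q S → x ∈ J → x ∈ S × q x ≡ false
∈-pieces⁻ {q} {S} J∈ x∈
  with x∈S , e ← ∈-filterᵇ⁻ _ S (subst (_ ∈_) (concat-pieces {q} S) (∈-concat⁺′ x∈ J∈)) = x∈S , not-true⁻ e

∈-pieces⁺ : ∀ {S x} → x ∈ S → q x ≡ false → ∃ λ J → J ∈ pieces q S × x ∈ J
∈-pieces⁺ {q} {S} x∈ e
  with J , x∈J , J∈ ← ∈-concat⁻′ (pieces q S)
         (subst (_ ∈_) (sym (concat-pieces {q} S)) (∈-filterᵇ⁺ x∈ (cong not e))) = J , J∈ , x∈J

pieces-sorted : ∀ {S} → AllPairs _<_ S → All (AllPairs _<_) (pieces q S) ×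
                AllPairs (λ J K → ∀ {x y} → x ∈ J → y ∈ K → x < y) (pieces q S)
pieces-sorted {q} {S} S! =
  AllPairs-concat⁻ (pieces q S) (subst (AllPairs _<_) (sym (concat-pieces {q} S)) (AllPairsP.filter⁺ _ S!))

rest-separator : ∀ {S J x} → AllPairs _<_ S → J ∈ rest q S → x ∈ J → ∃ λ z → z ∈ S × q z ≡ true × z < x
rest-separator {q} {s ∷ S} (s< ∷ S!) J∈ x∈ with q s in qs
... | true  = s , here refl , qs , All.lookup s< (proj₁ (∈-pieces⁻ {q} {S} J∈ x∈))
... | false with z , z∈ , qz , z<x ← rest-separator S! J∈ x∈ = z , there z∈ , qz , z<x

∈-first : ∀ {S y} → AllPairs _<_ S → y ∈ S → q y ≡ false →
          (∀ {z} → z ∈ S → q z ≡ true → z < y → ⊥) → y ∈ first q S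
∈-first {q} {s ∷ S} (s< ∷ S!) (here refl) qy nosep rewrite qy = here refl
∈-first {q} {s ∷ S} (s< ∷ S!) (there y∈)  qy nosep with q s in qs
... | true  = ⊥-elim (nosep (here refl) qs (All.lookup s< y∈))
... | false = there (∈-first S! y∈ qy (nosep ∘ there))

-- If `x` and `y` lay in different pieces, the separator in front of the later piece would fall
-- between them. The two hypotheses cover the two possible orders of `x` and `y`.
no-separator : ∀ {S J x y} → AllPairs _<_ S → J ∈ pieces q S → x ∈ J → y ∈ S → q y ≡ false →
               (∀ {z} → z ∈ S → q z ≡ true → x < z → z < y → ⊥) →
               (∀ {z} → z ∈ S → q z ≡ true → y < z → z < x → ⊥) → y ∈ J
no-separator {q} {[]} S! J∈ x∈ () qy f g
no-separator {q} {s ∷ S} (s< ∷ S!) J∈ x∈ y∈ qy f g with q s in qs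
no-separator {q} {s ∷ S} (s< ∷ S!) (here refl) () y∈ qy f g | true
no-separator {q} {s ∷ S} (s< ∷ S!) (there J∈) x∈ (here refl) qy f g | true = ⊥-elim (true≢false qs qy)
no-separator {q} {s ∷ S} (s< ∷ S!) (there J∈) x∈ (there y∈) qy f g | true =
  no-separator S! J∈ x∈ y∈ qy (f ∘ there) (g ∘ there)
no-separator {q} {s ∷ S} (s< ∷ S!) (here refl) x∈ (here refl) qy f g | false = here refl
no-separator {q} {s ∷ S} (s< ∷ S!) (here refl) (here refl) (there y∈) qy f g | false =
  there (∈-first S! y∈ qy λ z∈ qz z<y → f (there z∈) qz (All.lookup s< z∈) z<y)
no-separator {q} {s ∷ S} (s< ∷ S!) (here refl) (there x∈) (there y∈) qy f g | false =
  there (no-separator S! (here refl) x∈ y∈ qy (f ∘ there) (g ∘ there))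
no-separator {q} {s ∷ S} (s< ∷ S!) (there J∈) x∈ (here refl) qy f g | false
  with z , z∈ , qz , z<x ← rest-separator S! J∈ x∈ = ⊥-elim (g (there z∈) qz (All.lookup s< z∈) z<x)
no-separator {q} {s ∷ S} (s< ∷ S!) (there J∈) x∈ (there y∈) qy f g | false =
  no-separator S! (there J∈) x∈ y∈ qy (f ∘ there) (g ∘ there)

-- Restriction of the inner blocks to a piece

subᵇ : List ℕ → Block → Bool
subᵇ J C = all (λ m → elemᵇ m J) C

restr : Partition → List ℕ → Partition
restr U J = filterᵇ (subᵇ J) U

sub⁺ : ∀ J C → C ⊆ J → subᵇ J C ≡ true
sub⁺ J C h = all-true⁺ C λ x∈ → elem⁺ (h x∈)

sub⁻ : ∀ J C → subᵇ J C ≡ true → C ⊆ J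
sub⁻ J C e x∈ = elem⁻ J (all-true⁻ e x∈)

∈-restr⁺ : ∀ {U J C} → C ∈ U → C ⊆ J → C ∈ restr U J
∈-restr⁺ C∈ h = ∈-filterᵇ⁺ C∈ (sub⁺ _ _ h)

∈-restr⁻ : ∀ U J {C} → C ∈ restr U J → C ∈ U × C ⊆ J
∈-restr⁻ U J C∈ with C∈U , e ← ∈-filterᵇ⁻ _ U C∈ = C∈U , sub⁻ _ _ e

concat-restr⁻ : ∀ U J {x} → x ∈ concat (restr U J) → x ∈ concat U × x ∈ J
concat-restr⁻ U J x∈ with C , x∈C , C∈ ← ∈-concat⁻′ (restr U J) x∈ with C∈U , C⊆J ← ∈-restr⁻ U J C∈ =
  ∈-concat⁺′ x∈C C∈U , C⊆J x∈C

minB-∈ : ∀ {B} → B ≢ [] → minB B ∈ B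
minB-∈ {[]}    h = ⊥-elim (h refl)
minB-∈ {x ∷ B} h = here refl

inQ : Partition → ℕ → Bool
inQ Q m = elemᵇ m (concat Q)

module _ {S P Q U} (nc : NCOn S P) (i : Interleaving Q U P) where

  private
    U⊑ : U ⊑ P
    U⊑ = interleaving-⊑ʳ i

    Q⊑ : Q ⊑ P
    Q⊑ = interleaving-⊑ˡ i

    U-∉Q : ∀ {C y} → C ∈ U → y ∈ C → inQ Q y ≡ false
    U-∉Q C∈ y∈ = ∉⇒elem-false λ y∈Q → interleaving-disjoint nc i y∈Q (∈-concat⁺′ y∈ C∈)

  -- If some B ∈ Q meets the gap between two elements x < y of C ∈ U, then, B and C not crossing, all of B lies strictly
  -- between inf C and sup C, which admissibility forbids.
  gap-empty : Adm Q U → ∀ {C x y z} → C ∈ U → x ∈ C → y ∈ C → inQ Q z ≡ true → x < z → z < y → ⊥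
  gap-empty adm {C} {x} {y} {z} C∈ x∈ y∈ z∈Q x<z z<y
    with B , z∈B , B∈ ← ∈-concat⁻′ Q (elem⁻ (concat Q) z∈Q) =
    true≢false (nested⁺ B C straddled) (adm B∈ C∈)
    where
    B≢C : B ≢ C
    B≢C = interleaving-≢ nc i B∈ C∈
    B∈P = Sub.lookup Q⊑ B∈
    C∈P = Sub.lookup U⊑ C∈
    separate : ∀ {m c} → m ∈ B → c ∈ C → m ≢ c
    separate m∈ c∈ refl = B≢C (unique-concat-block (unique nc) B∈P C∈P m∈ c∈)
    straddled : ∀ {m} → m ∈ B → Straddles C m
    straddled {m} m∈ = below , above
      where
      below : ∃ λ c → c ∈ C × c < m
      below with <-cmp x m
      ... | tri< x<m _ _ = x , x∈ , x<m
      ... | tri≈ _ x≡m _ = ⊥-elim (separate m∈ x∈ (sym x≡m))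
      ... | tri> _ _ m<x = ⊥-elim (nonCrossing nc B∈P C∈P B≢C m∈ z∈B x∈ y∈ m<x x<z z<y)
      above : ∃ λ c → c ∈ C × m < c
      above with <-cmp m y
      ... | tri< m<y _ _ = y , y∈ , m<y
      ... | tri≈ _ m≡y _ = ⊥-elim (separate m∈ y∈ m≡y)
      ... | tri> _ _ y<m = ⊥-elim (nonCrossing nc C∈P B∈P (B≢C ∘ sym) x∈ y∈ z∈B m∈ x<z z<y y<m)

  block-in-piece : Adm Q U → ∀ {J C x} → J ∈ pieces (inQ Q) S → C ∈ U → x ∈ J → x ∈ C → C ⊆ J
  block-in-piece adm J∈ C∈ x∈J x∈C y∈C =
    no-separator (sorted nc) J∈ x∈J (block-⊆ nc (Sub.lookup U⊑ C∈) y∈C) (U-∉Q C∈ y∈C)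
      (λ _ z∈Q x<z z<y → gap-empty adm C∈ x∈C y∈C z∈Q x<z z<y)
      (λ _ z∈Q y<z z<x → gap-empty adm C∈ y∈C x∈C z∈Q y<z z<x)

  block-has-piece : Adm Q U → ∀ {C} → C ∈ U → ∃ λ J → J ∈ pieces (inQ Q) S × C ⊆ J
  block-has-piece adm C∈ with m∈ ← minB-∈ (All.lookup (nonempty nc) (Sub.lookup U⊑ C∈))
    with J , J∈ , m∈J ← ∈-pieces⁺ (block-⊆ nc (Sub.lookup U⊑ C∈) m∈) (U-∉Q C∈ m∈) =
    J , J∈ , block-in-piece adm J∈ C∈ m∈J m∈

  piece-covered : Adm Q U → ∀ {J x} → J ∈ pieces (inQ Q) S → x ∈ J → ∃ λ C → C ∈ U × x ∈ C × C ⊆ J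
  piece-covered adm J∈ x∈ with x∈S , x∉Q ← ∈-pieces⁻ J∈ x∈ with interleaving-concat i (covers nc x∈S)
  ... | inj₁ x∈Q = ⊥-elim (true≢false (elem⁺ x∈Q) x∉Q)
  ... | inj₂ x∈U with C , x∈C , C∈ ← ∈-concat⁻′ U x∈U = C , C∈ , x∈C , block-in-piece adm J∈ C∈ x∈ x∈C

  -- Admissibility is what makes the restricted blocks cover `J`: a block of `U` spread over several
  -- pieces would be discarded by `restr`, leaving its elements in no block.
  piece-NC : Adm Q U → ∀ {J} → J ∈ pieces (inQ Q) S → NCOn J (restr U J)
  piece-NC adm {J} J∈ = subNC nc (Sub.⊆-trans (filterᵇ-⊑ _ U) U⊑)
    (All.lookup (proj₁ (pieces-sorted (sorted nc))) J∈)
    (λ x∈ → let C , C∈ , x∈C , C⊆J = piece-covered adm J∈ x∈ in ∈-concat⁺′ x∈C (∈-restr⁺ C∈ C⊆J))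
    (λ x∈ → proj₂ (concat-restr⁻ U J x∈))

-- Decomposition of the inner blocks along the pieces

-- Exactly what is needed to turn the product of the coproducts of the pieces into one sum over the
-- splittings of `V`: the blocks of the first piece are an initial segment, no block fits into a
-- piece other than its own, and nothing nests across this division in either direction.
data Decomp : List (List ℕ) → Partition → Set where
  []   : Decomp [] []
  cons : ∀ {J Js V₁ V₂} → NCOn J V₁ → Decomp Js V₂ →
         (∀ {B K} → B ∈ V₁ → K ∈ Js → subᵇ K B ≡ false) → (∀ {C} → C ∈ V₂ → subᵇ J C ≡ false) →
         Adm V₁ V₂ → Adm V₂ V₁ → Decomp (J ∷ Js) (V₁ ++ V₂)

-- The predicate is closed downwards along the order of the list, so it holds on an initial segment
-- and fails from there on.
filterᵇ-partition : ∀ {R : A → A → Set} {p : A → Bool} {xs} → AllPairs R xs →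
                    (∀ {x y} → x ∈ xs → y ∈ xs → R x y → p y ≡ true → p x ≡ true) →
                    filterᵇ p xs ++ filterᵇ (not ∘ p) xs ≡ xs
filterᵇ-partition []               h = refl
filterᵇ-partition {p = p} {x ∷ xs} (r ∷ rs) h with p x in px
... | true  = cong (x ∷_) (filterᵇ-partition rs λ x∈ y∈ → h (there x∈) (there y∈))
... | false rewrite filterᵇ-none {p = p} xs (λ y∈ → not-true⁻ (not-true⁺ λ py →
                      true≢false (h (here refl) (there y∈) (All.lookup r y∈) py) px))
                  | filterᵇ-all {p = not ∘ p} xs (λ y∈ → not-true⁺ λ py →
                      true≢false (h (here refl) (there y∈) (All.lookup r y∈) py) px) = refl

-- The pieces increase and the blocks are listed by minima, so the blocks inside `J` come before all
-- others. A nesting between a block in `J` and a block in a later piece is impossible: it would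
-- need an element of the later piece below one of `J`.
decompose : ∀ Js V → AllPairs (λ J K → ∀ {x y} → x ∈ J → y ∈ K → x < y) Js →
            AllPairs (λ B C → minB B < minB C) V → All (λ B → B ≢ []) V →
            (∀ {C} → C ∈ V → ∃ λ J → J ∈ Js × C ⊆ J) →
            (∀ {J} → J ∈ Js → NCOn J (restr V J)) → Decomp Js V
decompose []       []      _ _ _ _ _ = []
decompose []       (C ∷ V) _ _ _ h _ with _ , () , _ ← h (here refl)
decompose (J ∷ Js) V (J< ∷ Js<) ord ne loc nc =
  subst (Decomp (J ∷ Js)) (filterᵇ-partition ord earlier)
    (cons (nc (here refl)) (decompose Js V₂ Js< (AllPairsP.filter⁺ _ ord) (AllP.filter⁺ _ ne) loc₂ nc₂)
      (λ B∈ K∈ → not-true⁻ (not-true⁺ λ B⊆K → let B∈V , B⊆J = ∈-restr⁻ V J B∈ in clash B∈V K∈ B⊆J (sub⁻ _ _ B⊆K)))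
      (λ C∈ → not-true⁻ (proj₂ (∈-filterᵇ⁻ _ V C∈)))
      (λ B∈ C∈ → not-true⁻ (not-true⁺ λ nest →
        let K , K∈ , C⊆K = loc₂ C∈ ; B∈V , B⊆J = ∈-restr⁻ V J B∈ ; m∈ = min∈ B∈V
            (c , c∈ , c<m) , _ = nested⁻ _ nest m∈ in <-asym c<m (All.lookup J< K∈ (B⊆J m∈) (C⊆K c∈))))
      (λ C∈ B∈ → not-true⁻ (not-true⁺ λ nest →
        let K , K∈ , C⊆K = loc₂ C∈ ; B∈V , B⊆J = ∈-restr⁻ V J B∈ ; m∈ = min∈ (proj₁ (∈-filterᵇ⁻ _ V C∈))
            _ , (b , b∈ , m<b) = nested⁻ _ nest m∈ in <-asym m<b (All.lookup J< K∈ (B⊆J b∈) (C⊆K m∈)))))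
  where
  V₂ = filterᵇ (not ∘ subᵇ J) V
  min∈ : ∀ {B} → B ∈ V → minB B ∈ B
  min∈ B∈ = minB-∈ (All.lookup ne B∈)
  clash : ∀ {B K} → B ∈ V → K ∈ Js → B ⊆ J → B ⊆ K → ⊥
  clash B∈ K∈ B⊆J B⊆K = <-irrefl refl (All.lookup J< K∈ (B⊆J (min∈ B∈)) (B⊆K (min∈ B∈)))
  earlier : ∀ {B C} → B ∈ V → C ∈ V → minB B < minB C → subᵇ J C ≡ true → subᵇ J B ≡ true
  earlier B∈ C∈ B<C C⊆J with loc B∈
  ... | _ , here refl , B⊆J = sub⁺ _ _ B⊆J
  ... | K , there K∈ , B⊆K = ⊥-elim (<-asym B<C (All.lookup J< K∈ (sub⁻ _ _ C⊆J (min∈ C∈)) (B⊆K (min∈ B∈))))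
  loc₂ : ∀ {C} → C ∈ V₂ → ∃ λ K → K ∈ Js × C ⊆ K
  loc₂ C∈ with C∈V , C⊈J ← ∈-filterᵇ⁻ _ V C∈ with loc C∈V
  ... | _ , here refl , C⊆J = ⊥-elim (true≢false (sub⁺ _ _ C⊆J) (not-true⁻ C⊈J))
  ... | K , there K∈ , C⊆K = K , K∈ , C⊆K
  nc₂ : ∀ {K} → K ∈ Js → NCOn K (restr V₂ K)
  nc₂ {K} K∈ = subst (NCOn K)
    (sym (filterᵇ-absorb V λ B∈ B⊆K → not-true⁺ λ B⊆J → clash B∈ K∈ (sub⁻ _ _ B⊆J) (sub⁻ _ _ B⊆K))) (nc (there K∈))

pieces-decomp : ∀ {S} → NCOn S P → Interleaving Q U P → Adm Q U → Decomp (pieces (inQ Q) S) U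
pieces-decomp nc i adm = decompose _ _ (proj₂ (pieces-sorted (sorted nc)))
  (AllPairs-resp-⊑ (interleaving-⊑ʳ i) (orderedBs nc)) (All.tabulate λ C∈ → All.lookup (nonempty nc) (Sub.lookup (interleaving-⊑ʳ i) C∈))
  (block-has-piece nc i adm) (piece-NC nc i adm)

-- Strictly increasing relabelling

-- Monotonicity is asked on `S` alone because the intended map `rank S` is constant between
-- consecutive elements of `S`.
Mono : (ℕ → ℕ) → List ℕ → Set
Mono φ S = ∀ {x y} → x ∈ S → y ∈ S → x < y → φ x < φ y

relabel : (ℕ → ℕ) → Partition → Partition
relabel φ = map (map φ)

concat-relabel : ∀ φ P → concat (relabel φ P) ≡ map φ (concat P)
concat-relabel φ P = concat-map P

minB-map : ∀ {φ B} → B ≢ [] → minB (map φ B) ≡ φ (minB B)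
minB-map {B = []}    h = ⊥-elim (h refl)
minB-map {B = _ ∷ _} h = refl

rank-↭ : ∀ {S S′} x → S ↭ S′ → rank S x ≡ rank S′ x
rank-↭ x S↭ = ↭-length (filter-↭ _ S↭)

stRel-↭ : ∀ {S S′} P → S ↭ S′ → stRel S P ≡ stRel S′ P
stRel-↭ P S↭ = map-cong (map-cong λ x → rank-↭ x S↭) P

module Relabel {φ S} (mono : Mono φ S) where

  reflects : ∀ {x y} → x ∈ S → y ∈ S → φ x < φ y → x < y
  reflects {x} {y} x∈ y∈ l with <-cmp x y
  ... | tri< x<y _ _ = x<y
  ... | tri≈ _ refl _ = ⊥-elim (<-irrefl refl l)
  ... | tri> _ _ y<x = ⊥-elim (<-asym l (mono y∈ x∈ y<x))

  injective : ∀ {x y} → x ∈ S → y ∈ S → φ x ≡ φ y → x ≡ y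
  injective {x} {y} x∈ y∈ e with <-cmp x y
  ... | tri< x<y _ _ = ⊥-elim (<-irrefl e (mono x∈ y∈ x<y))
  ... | tri≈ _ x≡y _ = x≡y
  ... | tri> _ _ y<x = ⊥-elim (<-irrefl (sym e) (mono y∈ x∈ y<x))

  ∈-map⁻-φ : ∀ {X x} → X ⊆ S → x ∈ S → φ x ∈ map φ X → x ∈ X
  ∈-map⁻-φ X⊆ x∈ φx∈ with y , y∈ , e ← ∈-map⁻ φ φx∈ rewrite injective x∈ (X⊆ y∈) e = y∈

  elem-map : ∀ {X x} → X ⊆ S → x ∈ S → elemᵇ (φ x) (map φ X) ≡ elemᵇ x X
  elem-map {X} X⊆ x∈ = bool-ext (λ e → elem⁺ (∈-map⁻-φ X⊆ x∈ (elem⁻ (map φ X) e)))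
                                (λ e → elem⁺ (∈-map⁺ φ (elem⁻ X e)))

  sub-map : ∀ {J C} → J ⊆ S → C ⊆ S → subᵇ (map φ J) (map φ C) ≡ subᵇ J C
  sub-map {J} {C} J⊆ C⊆ = bool-ext
    (λ e → sub⁺ J C λ x∈ → ∈-map⁻-φ J⊆ (C⊆ x∈) (sub⁻ (map φ J) (map φ C) e (∈-map⁺ φ x∈)))
    (λ e → sub⁺ (map φ J) (map φ C) λ φx∈ → let x , x∈ , eq = ∈-map⁻ φ φx∈ in
             subst (_∈ map φ J) (sym eq) (∈-map⁺ φ (sub⁻ J C e x∈)))

  restr-map : ∀ {U J} → concat U ⊆ S → J ⊆ S → restr (relabel φ U) (map φ J) ≡ relabel φ (restr U J)
  restr-map {U} {J} U⊆ J⊆ = trans (filterᵇ-map _ (map φ) U)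
    (cong (relabel φ) (filterᵇ-cong U λ C∈ → sub-map J⊆ λ x∈ → U⊆ (∈-concat⁺′ x∈ C∈)))

  nested-map : ∀ {B C} → B ⊆ S → C ⊆ S → nestedᵇ (map φ B) (map φ C) ≡ nestedᵇ B C
  nested-map {B} {C} B⊆ C⊆ = bool-ext (λ e → nested⁺ B C (pull e)) (λ e → nested⁺ (map φ B) (map φ C) (push e))
    where
    pull : nestedᵇ (map φ B) (map φ C) ≡ true → ∀ {m} → m ∈ B → Straddles C m
    pull e m∈ with (a , a∈ , a<) , (b , b∈ , <b) ← nested⁻ (map φ C) e (∈-map⁺ φ m∈)
      with a′ , a′∈ , refl ← ∈-map⁻ φ a∈ | b′ , b′∈ , refl ← ∈-map⁻ φ b∈ =
      (a′ , a′∈ , reflects (C⊆ a′∈) (B⊆ m∈) a<) , (b′ , b′∈ , reflects (B⊆ m∈) (C⊆ b′∈) <b)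
    push : nestedᵇ B C ≡ true → ∀ {m} → m ∈ map φ B → Straddles (map φ C) m
    push e φm∈ with m , m∈ , refl ← ∈-map⁻ φ φm∈
      with (a , a∈ , a<) , (b , b∈ , <b) ← nested⁻ C e m∈ =
      (φ a , ∈-map⁺ φ a∈ , mono (C⊆ a∈) (B⊆ m∈) a<) , (φ b , ∈-map⁺ φ b∈ , mono (B⊆ m∈) (C⊆ b∈) <b)

  adm-map : ∀ {Q U} → concat Q ⊆ S → concat U ⊆ S → admissibleᵇ (relabel φ Q) (relabel φ U) ≡ admissibleᵇ Q U
  adm-map {Q} {U} Q⊆ U⊆ = bool-ext
    (λ e → adm⁺ Q U λ B∈ C∈ → trans (sym (eq B∈ C∈)) (adm⁻ _ _ e (∈-map⁺ _ B∈) (∈-map⁺ _ C∈)))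
    (λ e → adm⁺ _ _ λ B∈ C∈ → push e (∈-map⁻ _ B∈) (∈-map⁻ _ C∈))
    where
    eq : ∀ {B C} → B ∈ Q → C ∈ U → nestedᵇ (map φ B) (map φ C) ≡ nestedᵇ B C
    eq B∈ C∈ = nested-map (λ x∈ → Q⊆ (∈-concat⁺′ x∈ B∈)) (λ x∈ → U⊆ (∈-concat⁺′ x∈ C∈))
    push : admissibleᵇ Q U ≡ true → ∀ {B C} → (∃ λ B′ → B′ ∈ Q × B ≡ map φ B′) →
           (∃ λ C′ → C′ ∈ U × C ≡ map φ C′) → nestedᵇ B C ≡ false
    push e (_ , B∈ , refl) (_ , C∈ , refl) = trans (eq B∈ C∈) (adm⁻ Q U e B∈ C∈)

  rank-map : ∀ {X x} → X ⊆ S → x ∈ S → rank (map φ X) (φ x) ≡ rank X x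
  rank-map {X} {x} X⊆ x∈ = trans (cong length (filterᵇ-map _ φ X)) (trans (length-map φ (filterᵇ (λ y → φ y ≤ᵇ φ x) X))
    (cong length (filterᵇ-cong {p = λ y → φ y ≤ᵇ φ x} {λ y → y ≤ᵇ x} X λ y∈ → bool-ext
      (λ e → T⇒true (≤⇒≤ᵇ (pull (X⊆ y∈) (≤ᵇ⇒≤ _ _ (true⇒T e)))))
      (λ e → T⇒true (≤⇒≤ᵇ (push (X⊆ y∈) (≤ᵇ⇒≤ _ _ (true⇒T e))))))))
    where
    pull : ∀ {y} → y ∈ S → φ y ≤ φ x → y ≤ x
    pull y∈ φy≤ = ≮⇒≥ λ x<y → <⇒≱ (mono x∈ y∈ x<y) φy≤
    push : ∀ {y} → y ∈ S → y ≤ x → φ y ≤ φ x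
    push y∈ y≤ = ≮⇒≥ λ φx< → <⇒≱ (reflects x∈ y∈ φx<) y≤

  -- A rank counts the elements that are not larger, so it sees only the order, and an increasing
  -- relabelling disappears after standardization.
  st-map : ∀ {P} → concat P ⊆ S → st (relabel φ P) ≡ st P
  st-map {P} P⊆ = trans (sym (map-∘ P)) (map-cong-∈ P λ B∈ → trans (sym (map-∘ _))
    (map-cong-∈ _ λ x∈ → trans (cong (λ X → rank X (φ _)) (concat-relabel φ P))
                               (rank-map P⊆ (P⊆ (∈-concat⁺′ x∈ B∈)))))

  leftWord-map : ∀ {P} → concat P ⊆ S → leftWord (relabel φ P) ≡ leftWord P
  leftWord-map {[]}    P⊆ = refl
  leftWord-map {B ∷ P} P⊆ = cong (_∷ []) (st-map {B ∷ P} P⊆)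

  map-NC : ∀ {P} → NCOn S P → NCOn (map φ S) (relabel φ P)
  map-NC {P} nc = record
    { sorted = AllPairs-map-∈ mono (sorted nc)
    ; nonempty = AllP.map⁺ (All.map (λ { {[]} h e → h refl }) (nonempty nc))
    ; sortedBs = AllP.map⁺ (All.tabulate λ B∈ →
        AllPairs-map-∈ (λ x∈ y∈ → mono (block-⊆ nc B∈ x∈) (block-⊆ nc B∈ y∈)) (All.lookup (sortedBs nc) B∈))
    ; orderedBs = AllPairs-map-∈ (λ B∈ C∈ l → subst₂ _<_ (sym (minB-map (ne B∈))) (sym (minB-map (ne C∈)))
        (mono (block-⊆ nc B∈ (minB-∈ (ne B∈))) (block-⊆ nc C∈ (minB-∈ (ne C∈))) l)) (orderedBs nc)
    ; unique = subst Unique (sym (concat-relabel φ P))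
        (AllPairs-map-∈ (λ x∈ y∈ x≢y e → x≢y (injective (within nc x∈) (within nc y∈) e)) (unique nc))
    ; covers = λ x∈ → let y , y∈ , e = ∈-map⁻ φ x∈ in
        subst₂ _∈_ (sym e) (sym (concat-relabel φ P)) (∈-map⁺ φ (covers nc y∈))
    ; within = λ x∈ → let y , y∈ , e = ∈-map⁻ φ (subst (_ ∈_) (concat-relabel φ P) x∈) in
        subst (_∈ map φ S) (sym e) (∈-map⁺ φ (within nc y∈))
    ; nonCrossing = λ B∈ C∈ → cross (∈-map⁻ _ B∈) (∈-map⁻ _ C∈) }
    where
    ne : ∀ {B} → B ∈ P → B ≢ []
    ne = All.lookup (nonempty nc)
    cross : ∀ {B C} → (∃ λ B′ → B′ ∈ P × B ≡ map φ B′) → (∃ λ C′ → C′ ∈ P × C ≡ map φ C′) → B ≢ C →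
            ∀ {p₁ q₁ p₂ q₂} → p₁ ∈ B → p₂ ∈ B → q₁ ∈ C → q₂ ∈ C → p₁ < q₁ → q₁ < p₂ → p₂ < q₂ → ⊥
    cross (B , B∈ , refl) (C , C∈ , refl) B≢C p₁∈ p₂∈ q₁∈ q₂∈ l₁ l₂ l₃
      with _ , a , refl ← ∈-map⁻ φ p₁∈ | _ , b , refl ← ∈-map⁻ φ p₂∈
         | _ , c , refl ← ∈-map⁻ φ q₁∈ | _ , d , refl ← ∈-map⁻ φ q₂∈ =
      nonCrossing nc B∈ C∈ (B≢C ∘ cong (map φ)) a b c d
        (reflects (b⊆ B∈ a) (b⊆ C∈ c) l₁) (reflects (b⊆ C∈ c) (b⊆ B∈ b) l₂) (reflects (b⊆ B∈ b) (b⊆ C∈ d) l₃)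
      where b⊆ = block-⊆ nc

-- Standardization

length-filterᵇ-≤ : ∀ {p q : A → Bool} xs → (∀ {x} → x ∈ xs → p x ≡ true → q x ≡ true) →
                   length (filterᵇ p xs) ≤ length (filterᵇ q xs)
length-filterᵇ-≤ []       h = z≤n
length-filterᵇ-≤ {p = p} {q} (x ∷ xs) h with p x in px | q x in qx
... | true  | true  = s≤s (length-filterᵇ-≤ xs (h ∘ there))
... | true  | false = ⊥-elim (true≢false (h (here refl) px) qx)
... | false | true  = m≤n⇒m≤1+n (length-filterᵇ-≤ xs (h ∘ there))
... | false | false = length-filterᵇ-≤ xs (h ∘ there)

length-filterᵇ-< : ∀ {p q : A → Bool} {xs y} → (∀ {x} → x ∈ xs → p x ≡ true → q x ≡ true) →
                   y ∈ xs → p y ≡ false → q y ≡ true → length (filterᵇ p xs) < length (filterᵇ q xs)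
length-filterᵇ-< {xs = x ∷ xs} h (here refl) py qy rewrite py | qy = s≤s (length-filterᵇ-≤ xs (h ∘ there))
length-filterᵇ-< {p = p} {q} {xs = x ∷ xs} h (there y∈) py qy with p x in px | q x in qx
... | true  | true  = s≤s (length-filterᵇ-< (h ∘ there) y∈ py qy)
... | true  | false = ⊥-elim (true≢false (h (here refl) px) qx)
... | false | true  = m≤n⇒m≤1+n (length-filterᵇ-< (h ∘ there) y∈ py qy)
... | false | false = length-filterᵇ-< (h ∘ there) y∈ py qy

-- The strict gain comes from `y` itself, which its own rank counts and the rank of `x` does not.
rank-mono : ∀ S → Mono (rank S) S
rank-mono S {x} {y} x∈ y∈ x<y = length-filterᵇ-<
  (λ {z} _ e → T⇒true (≤⇒≤ᵇ (≤-trans (≤ᵇ⇒≤ z x (true⇒T e)) (<⇒≤ x<y)))) y∈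
  (not-true⁻ (not-true⁺ λ e → <⇒≱ x<y (≤ᵇ⇒≤ _ _ (true⇒T e)))) (T⇒true (≤⇒≤ᵇ (≤-refl {y})))

range-suc : ∀ n → range (suc n) ≡ 1 ∷ map suc (range n)
range-suc n = cong (λ xs → 1 ∷ map suc xs) (sym (map-applyUpTo id suc n))

-- Putting a smaller element in front raises all later ranks by one. Counting is with `≤`, so the
-- new element counts itself and gets rank 1.
map-rank : ∀ {S} → AllPairs _<_ S → map (rank S) S ≡ range (length S)
map-rank []                     = refl
map-rank {x ∷ S} (x< ∷ S!) = trans (cong₂ _∷_ head tail) (sym (range-suc (length S)))
  where
  head : rank (x ∷ S) x ≡ 1
  head rewrite T⇒true (≤⇒≤ᵇ (≤-refl {x})) =
    cong (suc ∘ length) (filterᵇ-none S λ y∈ → not-true⁻ (not-true⁺ λ e →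
      <⇒≱ (All.lookup x< y∈) (≤ᵇ⇒≤ _ _ (true⇒T e))))
  tail : map (rank (x ∷ S)) S ≡ map suc (range (length S))
  tail = trans (map-cong-∈ S λ y∈ → shift (All.lookup x< y∈)) (trans (map-∘ S) (cong (map suc) (map-rank S!)))
    where
    shift : ∀ {y} → x < y → rank (x ∷ S) y ≡ suc (rank S y)
    shift {y} x<y rewrite T⇒true (≤⇒≤ᵇ (<⇒≤ x<y)) = refl

range-sorted : ∀ n → AllPairs _<_ (range n)
range-sorted n = AllPairsP.map⁺ (AllPairsP.applyUpTo⁺₁ id n λ i<j _ → s≤s i<j)

length-range : ∀ n → length (range n) ≡ n
length-range n = trans (length-map suc (upTo n)) (length-applyUpTo id n)

rank-range : ∀ {n x} → x ∈ range n → rank (range n) x ≡ x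
rank-range {n} = pointwise (range n) (trans (map-rank (range-sorted n)) (cong range (length-range n)))
  where
  pointwise : ∀ {f : ℕ → ℕ} xs → map f xs ≡ xs → ∀ {x} → x ∈ xs → f x ≡ x
  pointwise (x ∷ xs) e (here refl) = ∷-injectiveˡ e
  pointwise (x ∷ xs) e (there x∈)  = pointwise xs (∷-injectiveʳ e) x∈

-- `concat P` lists `S` block by block rather than in increasing order, but counting ignores the
-- order of the list.
st≡stRel : ∀ {S} → NCOn S P → st P ≡ stRel S P
st≡stRel {P} nc = stRel-↭ P (perm nc)

st-NC : ∀ {S} → NCOn S P → NCOn (range (length S)) (st P)
st-NC {S = S} nc = subst₂ NCOn (map-rank (sorted nc)) (sym (st≡stRel nc)) (Relabel.map-NC (rank-mono S) nc)

st-range : ∀ {n} → NCOn (range n) P → st P ≡ P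
st-range {P} {n} nc = trans (st≡stRel nc) (trans (map-cong-∈ P λ B∈ →
  trans (map-cong-∈ _ λ x∈ → rank-range (block-⊆ nc B∈ x∈)) (map-id _)) (map-id P))

degP-NC : ∀ {S} → NCOn S P → degP P ≡ length S
degP-NC nc = ↭-length (perm nc)

Unique-resp-↭ : {xs ys : List A} → xs ↭ ys → Unique xs → Unique ys
Unique-resp-↭ Perm.refl         u = u
Unique-resp-↭ (Perm.prep x p)   (a ∷ u) = All-resp-↭ p a ∷ Unique-resp-↭ p u
Unique-resp-↭ (Perm.swap x y p) ((n ∷ a) ∷ b ∷ u) =
  (n ∘ sym ∷ All-resp-↭ p b) ∷ All-resp-↭ p a ∷ Unique-resp-↭ p u
Unique-resp-↭ (Perm.trans p q)  u = Unique-resp-↭ q (Unique-resp-↭ p u)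

AllPairs-lookup : ∀ {R : A → A → Set} {xs} → AllPairs R xs → (i j : Fin (length xs)) → i ≢ j →
                  R (lookup xs i) (lookup xs j) ⊎ R (lookup xs j) (lookup xs i)
AllPairs-lookup (r ∷ rs) zero    zero    h = ⊥-elim (h refl)
AllPairs-lookup (r ∷ rs) zero    (suc j) h = inj₁ (All.lookup r (∈-lookup j))
AllPairs-lookup (r ∷ rs) (suc i) zero    h = inj₂ (All.lookup r (∈-lookup i))
AllPairs-lookup (r ∷ rs) (suc i) (suc j) h = AllPairs-lookup rs i j (h ∘ cong suc)

IsNCPartition⇒NCOn : ∀ {n} → IsNCPartition n P → NCOn (range n) P
IsNCPartition⇒NCOn {P} {n} nc = record
  { sorted = range-sorted n ; nonempty = nonemptyBlocks ; sortedBs = sortedBlocks ; orderedBs = orderedBlocks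
  ; unique = Unique-resp-↭ (↭-sym covs) (sorted⇒unique (range-sorted n))
  ; covers = ∈-resp-↭ (↭-sym covs) ; within = ∈-resp-↭ covs
  ; nonCrossing = λ B∈ C∈ B≢C p₁∈ p₂∈ q₁∈ q₂∈ l₁ l₂ l₃ →
      noncross (index B∈) (index C∈)
        (λ e → B≢C (trans (AnyP.lookup-index B∈) (trans (cong (lookup P) e) (sym (AnyP.lookup-index C∈))))) _ _ _ _
        (subst (_ ∈_) (AnyP.lookup-index B∈) p₁∈) (subst (_ ∈_) (AnyP.lookup-index B∈) p₂∈)
        (subst (_ ∈_) (AnyP.lookup-index C∈) q₁∈) (subst (_ ∈_) (AnyP.lookup-index C∈) q₂∈) (l₁ , l₂ , l₃) }
  where
  open IsNCPartition nc renaming (covers to covs; nonCrossing to noncross)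

NCOn⇒IsNCPartition : ∀ {n} → 1 ≤ n → NCOn (range n) P → IsNCPartition n P
NCOn⇒IsNCPartition {P} n≥1 nc = record
  { n≥1 = n≥1 ; nonemptyBlocks = nonempty nc ; sortedBlocks = sortedBs nc ; orderedBlocks = orderedBs nc
  ; covers = perm nc
  ; nonCrossing = λ i j i≢j p₁ q₁ p₂ q₂ p₁∈ p₂∈ q₁∈ q₂∈ (l₁ , l₂ , l₃) →
      nonCrossing nc (∈-lookup i) (∈-lookup j) (distinct i j i≢j) p₁∈ p₂∈ q₁∈ q₂∈ l₁ l₂ l₃ }
  where
  distinct : ∀ i j → i ≢ j → lookup P i ≢ lookup P j
  distinct i j i≢j e = [ <-irrefl (cong minB e) , <-irrefl (cong minB (sym e)) ]′
    (AllPairs-lookup (orderedBs nc) i j i≢j)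

-- Empty pieces are kept: leftWord is the empty word on them, which makes the formula uniform in the piece.
innerWord : List ℕ → Partition → Partition → Word
innerWord S Q U = concatMap (λ J → leftWord (restr U J)) (pieces (inQ Q) S)

leftWord-valid : ∀ {S} → NCOn S P → ValidWord (leftWord P)
leftWord-valid {[]}          nc = []
leftWord-valid {B ∷ P} {[]}     nc with () ← NCOn-[] nc
leftWord-valid {B ∷ P} {s ∷ S}  nc = (_ , NCOn⇒IsNCPartition (s≤s z≤n) (st-NC nc)) ∷ []

leftWord-deg : ∀ {S} → NCOn S P → degW (leftWord P) ≡ length S
leftWord-deg {[]}    {[]}    nc = refl
leftWord-deg {[]}    {_ ∷ _} nc with () ← covers nc (here refl)
leftWord-deg {B ∷ P} {S}     nc = trans (ℕP.+-identityʳ _) (trans (cong length (concat-relabel _ (B ∷ P)))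
  (trans (length-map _ (concat (B ∷ P))) (degP-NC nc)))

degW-++ : ∀ u v → degW (u ++ v) ≡ degW u +ℕ degW v
degW-++ []      v = refl
degW-++ (L ∷ u) v = trans (cong (degP L +ℕ_) (degW-++ u v)) (sym (ℕP.+-assoc (degP L) _ _))

concatMap-leftWord : ∀ {U} Js → (∀ {J} → J ∈ Js → NCOn J (restr U J)) →
                     ValidWord (concatMap (λ J → leftWord (restr U J)) Js) ×
                     degW (concatMap (λ J → leftWord (restr U J)) Js) ≡ length (concat Js)
concatMap-leftWord []       h = [] , refl
concatMap-leftWord {U} (J ∷ Js) h with v , d ← concatMap-leftWord {U} Js (h ∘ there) =
  AllP.++⁺ (leftWord-valid (h (here refl))) v ,
  trans (degW-++ (leftWord (restr U J)) _)
    (trans (cong₂ _+ℕ_ (leftWord-deg (h (here refl))) d) (sym (length-++ J)))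

innerWord-valid : ∀ {S} → NCOn S P → Interleaving Q U P → Adm Q U → ValidWord (innerWord S Q U)
innerWord-valid {U = U} nc i adm = proj₁ (concatMap-leftWord {U} _ (piece-NC nc i adm))

-- The elements of `S` in blocks of `Q` are counted by the left word, and the pieces exhaust the
-- remaining ones.
split-deg : ∀ {S} → NCOn S P → Interleaving Q U P → Adm Q U →
            degW (leftWord Q) +ℕ degW (innerWord S Q U) ≡ length S
split-deg {Q = Q} {U} {S = S} nc i adm = trans
  (cong₂ _+ℕ_ (leftWord-deg (interleaving-NCˡ nc i))
    (trans (proj₂ (concatMap-leftWord {U} _ (piece-NC nc i adm))) (cong length (concat-pieces {inQ Q} S))))
  (length-filterᵇ-not (inQ Q) S)

innerWord-map : ∀ {φ S} → Mono φ S → concat Q ⊆ S → concat U ⊆ S →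
                innerWord (map φ S) (relabel φ Q) (relabel φ U) ≡ innerWord S Q U
innerWord-map {Q} {U} {φ} {S} mono Q⊆ U⊆ = trans
  (cong (concatMap _) (pieces-map {q′ = inQ (relabel φ Q)} {q = inQ Q} S λ {x} x∈ →
    trans (cong (elemᵇ (φ x)) (concat-relabel φ Q)) (elem-map Q⊆ x∈)))
  (trans (concatMap-map _ (map φ) (pieces (inQ Q) S))
    (concatMap-cong-∈ (pieces (inQ Q) S) λ {J} J∈ → trans
      (cong leftWord (restr-map {U} U⊆ λ x∈ → proj₁ (∈-pieces⁻ {inQ Q} {S} J∈ x∈)))
      (leftWord-map {restr U J} λ x∈ → U⊆ (proj₁ (concat-restr⁻ U J x∈)))))
  where open Relabel mono

-- The runs of consecutive integers are the nonempty pieces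

data Consecutive : ℕ → List ℕ → Set where
  []  : ∀ {k} → Consecutive k []
  _∷_ : ∀ k {xs} → Consecutive (suc k) xs → Consecutive k (k ∷ xs)

range-consecutive : ∀ n → Consecutive 1 (range n)
range-consecutive n = go n id 1 (λ i → refl)
  where
  go : ∀ n (f : ℕ → ℕ) k → (∀ i → suc (f i) ≡ k +ℕ i) → Consecutive k (map suc (applyUpTo f n))
  go zero    f k h = []
  go (suc n) f k h rewrite trans (h 0) (ℕP.+-identityʳ k) =
    k ∷ go n (f ∘ suc) (suc k) (λ i → trans (h (suc i)) (ℕP.+-suc k i))

consecutive-≤ : ∀ {k xs x} → Consecutive k xs → x ∈ xs → k ≤ x
consecutive-≤ (k ∷ c) (here refl) = ≤-refl
consecutive-≤ (k ∷ c) (there x∈)  = <⇒≤ (consecutive-≤ c x∈)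

nonEmpties : List (List A) → List (List A)
nonEmpties []                 = []
nonEmpties ([] ∷ xss)         = nonEmpties xss
nonEmpties (xs@(_ ∷ _) ∷ xss) = xs ∷ nonEmpties xss

∈-nonEmpties⁻ : ∀ {xs} (xss : List (List A)) → xs ∈ nonEmpties xss → xs ∈ xss
∈-nonEmpties⁻ ([] ∷ xss)      xs∈         = there (∈-nonEmpties⁻ xss xs∈)
∈-nonEmpties⁻ ((x ∷ xs) ∷ xss) (here refl) = here refl
∈-nonEmpties⁻ ((x ∷ xs) ∷ xss) (there xs∈) = there (∈-nonEmpties⁻ xss xs∈)

nonEmpties-≢[] : (xss : List (List A)) → [] ∉ nonEmpties xss
nonEmpties-≢[] ([] ∷ xss)       e∈         = nonEmpties-≢[] xss e∈
nonEmpties-≢[] ((x ∷ xs) ∷ xss) (there e∈) = nonEmpties-≢[] xss e∈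

-- Among consecutive integers two kept elements lie in the same run exactly when nothing between
-- them was removed. Adjacent separators enclose an empty piece, which `runs` does not see.
runs-pieces : ∀ {k S} → Consecutive k S → runs (filterᵇ (not ∘ q) S) ≡ nonEmpties (pieces q S)
runs-pieces {q} [] = refl
runs-pieces {q} (k ∷ c) with q k
runs-pieces {q} (k ∷ c) | true = runs-pieces c
runs-pieces {q} (k ∷ []) | false = refl
runs-pieces {q} (k ∷ c@(.(suc k) ∷ c′)) | false with ih ← runs-pieces {q} c with q (suc k)
runs-pieces {q} (k ∷ c@(.(suc k) ∷ c′)) | false | false
  rewrite ih | T⇒true (≡⇒≡ᵇ k k refl) = refl
-- Here `suc k` is removed. The next run, if there is one, starts at some `y` above `suc k`, so the
-- test `suc k ≡ᵇ y` fails and `k` forms a run of its own.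
runs-pieces {q} (k ∷ c@(_∷_ .(suc k) {S} c′)) | false | true rewrite ih
  with nonEmpties (pieces q S) in eq
... | []            = refl
... | [] ∷ _        = ⊥-elim (nonEmpties-≢[] (pieces q S) (subst ([] ∈_) (sym eq) (here refl)))
... | (y ∷ r) ∷ rs rewrite not-true⁻ {suc k ≡ᵇ y} (not-true⁺ λ e → <⇒≢
  (consecutive-≤ c′ (proj₁ (∈-pieces⁻ {q} {S}
    (∈-nonEmpties⁻ (pieces q S) (subst ((y ∷ r) ∈_) (sym eq) (here refl))) (here refl))))
  (≡ᵇ⇒≡ _ _ (true⇒T e))) = refl

-- An empty piece carries no block and contributes the empty word to the right-hand side. On a
-- nonempty piece `restrictSt` ranks within `J` and `leftWord` within the union of the blocks; these
-- have the same elements because the blocks cover `J`.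
restrictSt-nonEmpties : ∀ Js → (∀ {J} → J ∈ Js → NCOn J (restr U J)) →
                        map (restrictSt U) (nonEmpties Js) ≡ concatMap (λ J → leftWord (restr U J)) Js
restrictSt-nonEmpties []                 h = refl
restrictSt-nonEmpties {U} ([] ∷ Js)      h rewrite NCOn-[] (h (here refl)) =
  restrictSt-nonEmpties {U} Js (h ∘ there)
restrictSt-nonEmpties {U} (J@(_ ∷ _) ∷ Js) h =
  cong₂ _++_ (single (h (here refl))) (restrictSt-nonEmpties {U} Js (h ∘ there))
  where
  single : ∀ {x xs P} → NCOn (x ∷ xs) P → stRel (x ∷ xs) P ∷ [] ≡ leftWord P
  single {P = []}    nc with () ← covers nc (here refl)
  single {P = B ∷ P} nc = cong (_∷ []) (sym (st≡stRel nc))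

rightWord≡innerWord : ∀ {n} → NCOn (range n) P → Interleaving Q U P → Adm Q U →
                      rightWord n Q U ≡ innerWord (range n) Q U
rightWord≡innerWord {Q = Q} {U} {n} nc i adm =
  trans (cong (map (restrictSt U)) (runs-pieces {inQ Q} (range-consecutive n)))
        (restrictSt-nonEmpties {U} _ (piece-NC nc i adm))

-- Compatibility of iterated splittings

reassociate : ∀ {xs ys zs ws vs : List A} → Interleaving xs ys ws → Interleaving ws zs vs →
              ∃ λ us → Interleaving xs us vs × Interleaving ys zs us
reassociate []        []        = _ , [] , []
reassociate i         (consʳ j) with us , a , b ← reassociate i j = _ , consʳ a , consʳ b
reassociate (consˡ i) (consˡ j) with us , a , b ← reassociate i j = _ , consˡ a , b
reassociate (consʳ i) (consˡ j) with us , a , b ← reassociate i j = _ , consʳ a , consˡ b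

adm-interleavingˡ : Interleaving Q₁ Q₂ Q → admissibleᵇ Q U ≡ admissibleᵇ Q₁ U ∧ admissibleᵇ Q₂ U
adm-interleavingˡ {Q₁} {Q₂} {Q} {U} i = bool-ext
  (λ e → ∧-true⁺ (adm⁺ Q₁ U λ B∈ → adm⁻ Q U e (Sub.lookup (interleaving-⊑ˡ i) B∈))
                 (adm⁺ Q₂ U λ B∈ → adm⁻ Q U e (Sub.lookup (interleaving-⊑ʳ i) B∈)))
  (λ e → let e₁ , e₂ = ∧-true⁻ e in
     adm⁺ Q U λ B∈ C∈ → [ (λ b → adm⁻ Q₁ U e₁ b C∈) , (λ b → adm⁻ Q₂ U e₂ b C∈) ]′ (interleaving-∈ i B∈))

adm-interleavingʳ : Interleaving Q₂ U V → admissibleᵇ Q V ≡ admissibleᵇ Q Q₂ ∧ admissibleᵇ Q U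
adm-interleavingʳ {Q₂} {U} {V} {Q} i = bool-ext
  (λ e → ∧-true⁺ (adm⁺ Q Q₂ λ B∈ C∈ → adm⁻ Q V e B∈ (Sub.lookup (interleaving-⊑ˡ i) C∈))
                 (adm⁺ Q U λ B∈ C∈ → adm⁻ Q V e B∈ (Sub.lookup (interleaving-⊑ʳ i) C∈)))
  (λ e → let e₁ , e₂ = ∧-true⁻ e in
     adm⁺ Q V λ B∈ C∈ → [ (λ c → adm⁻ Q Q₂ e₁ B∈ c) , (λ c → adm⁻ Q U e₂ B∈ c) ]′ (interleaving-∈ i C∈))

-- Cutting the support of `Q` at `Q₁` gives the pieces of `S` at `Q₁` with the elements of `U`
-- deleted. Blocks of `Q₂` contain no such element, so the deletion does not change which of them
-- fit into a piece.
innerWord-middle : ∀ {S} → NCOn S P → Interleaving Q U P → Interleaving Q₁ Q₂ Q →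
                   innerWord (filterᵇ (inQ Q) S) Q₁ Q₂ ≡
                   concatMap (λ J → leftWord (restr Q₂ J)) (pieces (inQ Q₁) S)
innerWord-middle {Q = Q} {Q₁ = Q₁} {Q₂} {S} nc i j = trans
  (cong (concatMap _) (pieces-filter {inQ Q₁} {inQ Q} S λ {x} _ e →
    elem⁺ {x} (Sub.lookup (concat-⊑ (interleaving-⊑ˡ j)) (elem⁻ (concat Q₁) e))))
  (trans (concatMap-map _ (filterᵇ (inQ Q)) (pieces (inQ Q₁) S))
    (concatMap-cong-∈ (pieces (inQ Q₁) S) λ {J} J∈ → cong leftWord
      (filterᵇ-cong {p = subᵇ (filterᵇ (inQ Q) J)} {subᵇ J} Q₂ λ {C} C∈ → bool-ext
      (λ e → sub⁺ J C λ x∈ → proj₁ (∈-filterᵇ⁻ _ J (sub⁻ (filterᵇ (inQ Q) J) C e x∈)))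
      (λ e → sub⁺ (filterᵇ (inQ Q) J) C λ x∈ → ∈-filterᵇ⁺ (sub⁻ J C e x∈)
        (elem⁺ (∈-concat⁺′ x∈ (Sub.lookup (interleaving-⊑ʳ j) C∈)))))))

concatMap-concatMap : ∀ {C : Set} (f : B → List C) (g : A → List B) (xs : List A) →
                      concatMap f (concatMap g xs) ≡ concatMap (λ x → concatMap f (g x)) xs
concatMap-concatMap f g []       = refl
concatMap-concatMap f g (x ∷ xs) = trans (concatMap-++ f (g x) _) (cong (concatMap f (g x) ++_) (concatMap-concatMap f g xs))

-- Inside a piece `J` left by `Q₁`, the elements of `Q` must be those of the blocks of `Q₂`
-- contained in `J`. This is where the admissibility of `Q₁` against both `Q₂` and `U` enters: a
-- block of `Q₂` that meets `J` lies in `J`.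
innerWord-inner : ∀ {S} → NCOn S P → Interleaving Q U P → Interleaving Q₁ Q₂ Q → Adm Q₁ Q₂ → Adm Q₁ U →
                  innerWord S Q U ≡
                  concatMap (λ J → innerWord J (restr Q₂ J) (restr U J)) (pieces (inQ Q₁) S)
innerWord-inner {P} {Q} {U} {Q₁} {Q₂} {S} nc i j adm₁ adm₂ with V , k , l ← reassociate j i = trans
  (cong (concatMap word) (pieces-refine {inQ Q₁} {inQ Q} S λ {x} _ e →
    elem⁺ {x} (Sub.lookup (concat-⊑ (interleaving-⊑ˡ j)) (elem⁻ (concat Q₁) e))))
  (trans (concatMap-concatMap word (pieces (inQ Q)) (pieces (inQ Q₁) S))
    (concatMap-cong-∈ (pieces (inQ Q₁) S) λ {J} J∈ → trans
      (cong (concatMap word) (pieces-cong {inQ Q} {inQ (restr Q₂ J)} J λ {x} x∈ → bool-ext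
        (λ e → elem⁺ {x} (down J∈ x∈ (elem⁻ (concat Q) e)))
        (λ e → elem⁺ {x} (Sub.lookup (concat-⊑ (interleaving-⊑ʳ j))
                        (proj₁ (concat-restr⁻ Q₂ J (elem⁻ (concat (restr Q₂ J)) e)))))))
      (concatMap-cong-∈ (pieces (inQ (restr Q₂ J)) J) λ {K} K∈ → cong leftWord (sym
        (filterᵇ-absorb {p = subᵇ J} {subᵇ K} U λ {C} C∈ e →
          sub⁺ J C λ x∈ → proj₁ (∈-pieces⁻ {S = J} K∈ (sub⁻ K C e x∈)))))))
  where
  word = λ J → leftWord (restr U J)
  adm : Adm Q₁ V
  adm B∈ C∈ = [ adm₁ B∈ , adm₂ B∈ ]′ (interleaving-∈ l C∈)
  down : ∀ {J x} → J ∈ pieces (inQ Q₁) S → x ∈ J → x ∈ concat Q → x ∈ concat (restr Q₂ J)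
  down {J} J∈ x∈J x∈Q with interleaving-concat j x∈Q
  ... | inj₁ x∈Q₁ = ⊥-elim (true≢false (elem⁺ x∈Q₁) (proj₂ (∈-pieces⁻ {S = S} J∈ x∈J)))
  ... | inj₂ x∈Q₂ with C , x∈C , C∈ ← ∈-concat⁻′ Q₂ x∈Q₂ =
    ∈-concat⁺′ x∈C (∈-restr⁺ C∈ (block-in-piece nc k adm J∈ (Sub.lookup (interleaving-⊑ˡ l) C∈) x∈J x∈C))

restr-++ˡ : ∀ {V₁ V₂} J → (∀ {B} → B ∈ V₁ → subᵇ J B ≡ true) → (∀ {B} → B ∈ V₂ → subᵇ J B ≡ false) →
            restr (V₁ ++ V₂) J ≡ V₁
restr-++ˡ {V₁} {V₂} J h₁ h₂ = trans (filterᵇ-++ _ V₁ V₂)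
  (trans (cong₂ _++_ (filterᵇ-all V₁ h₁) (filterᵇ-none V₂ h₂)) (++-identityʳ V₁))

restr-++ʳ : ∀ {V₁ V₂} J → (∀ {B} → B ∈ V₁ → subᵇ J B ≡ false) → restr (V₁ ++ V₂) J ≡ restr V₂ J
restr-++ʳ {V₁} {V₂} J h = trans (filterᵇ-++ _ V₁ V₂) (cong (_++ restr V₂ J) (filterᵇ-none V₁ h))

adm-++ : ∀ Q₁ U₁ Q₂ U₂ → Adm Q₁ U₂ → Adm Q₂ U₁ →
         admissibleᵇ (Q₁ ++ Q₂) (U₁ ++ U₂) ≡ admissibleᵇ Q₁ U₁ ∧ admissibleᵇ Q₂ U₂
adm-++ Q₁ U₁ Q₂ U₂ h₁₂ h₂₁ = bool-ext
  (λ e → ∧-true⁺ (adm⁺ Q₁ U₁ λ B∈ C∈ → adm⁻ (Q₁ ++ Q₂) (U₁ ++ U₂) e (∈-++⁺ˡ B∈) (∈-++⁺ˡ C∈))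
                 (adm⁺ Q₂ U₂ λ B∈ C∈ → adm⁻ (Q₁ ++ Q₂) (U₁ ++ U₂) e (∈-++⁺ʳ Q₁ B∈) (∈-++⁺ʳ U₁ C∈)))
  (λ e → let e₁ , e₂ = ∧-true⁻ e in adm⁺ (Q₁ ++ Q₂) (U₁ ++ U₂) λ B∈ C∈ → go e₁ e₂ (∈-++⁻ Q₁ B∈) (∈-++⁻ U₁ C∈))
  where
  go : admissibleᵇ Q₁ U₁ ≡ true → admissibleᵇ Q₂ U₂ ≡ true → ∀ {B C} →
       B ∈ Q₁ ⊎ B ∈ Q₂ → C ∈ U₁ ⊎ C ∈ U₂ → nestedᵇ B C ≡ false
  go e₁ e₂ (inj₁ b) (inj₁ c) = adm⁻ Q₁ U₁ e₁ b c
  go e₁ e₂ (inj₁ b) (inj₂ c) = h₁₂ b c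
  go e₁ e₂ (inj₂ b) (inj₁ c) = h₂₁ b c
  go e₁ e₂ (inj₂ b) (inj₂ c) = adm⁻ Q₂ U₂ e₂ b c

adm-[]ʳ : ∀ Q → admissibleᵇ Q [] ≡ true
adm-[]ʳ Q = adm⁺ Q [] λ _ ()

innerWord-∅ˡ : ∀ {S P} → NCOn S P → innerWord S [] P ≡ leftWord P
innerWord-∅ˡ {S} {P} nc = trans (cong (concatMap _) (whole S))
  (trans (++-identityʳ _) (cong leftWord (filterᵇ-all P λ B∈ → sub⁺ S _ (block-⊆ nc B∈))))
  where
  whole : ∀ S → pieces (inQ []) S ≡ S ∷ []
  whole []      = refl
  whole (x ∷ S) = cong₂ _∷_ (cong (x ∷_) (∷-injectiveˡ (whole S))) (∷-injectiveʳ (whole S))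

innerWord-∅ʳ : ∀ S Q → innerWord S Q [] ≡ []
innerWord-∅ʳ S Q = none (pieces (inQ Q) S)
  where
  none : ∀ (Js : List (List ℕ)) → concatMap (λ J → leftWord (restr [] J)) Js ≡ []
  none []       = refl
  none (_ ∷ Js) = none Js

concatMap-[]⁻ : ∀ {A B : Set} {f : A → List B} {xs x} → concatMap f xs ≡ [] → x ∈ xs → f x ≡ []
concatMap-[]⁻ {f = f} {y ∷ xs} e (here refl) = ++-conicalˡ (f y) _ e
concatMap-[]⁻ {f = f} {y ∷ xs} e (there x∈)    = concatMap-[]⁻ {xs = xs} (++-conicalʳ (f y) _ e) x∈

-- Any block of `U` lies in some piece, and that piece contributes a letter. The right counit law
-- rests on this; for the left one the corresponding fact about `leftWord` holds by computation.
innerWord-≢[] : ∀ {S P Q U} → NCOn S P → Interleaving Q U P → Adm Q U → U ≢ [] → innerWord S Q U ≢ []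
innerWord-≢[] {U = []}    nc i adm U≢ _ = U≢ refl
innerWord-≢[] {S} {Q = Q} {U = C ∷ U} nc i adm U≢ e with J , J∈ , C⊆J ← block-has-piece nc i adm (here refl) =
  contra (∈-restr⁺ (here refl) C⊆J) (concatMap-[]⁻ {xs = pieces (inQ Q) S} e J∈)
  where
  contra : ∀ {P} → C ∈ P → leftWord P ≢ []
  contra (here _)  ()
  contra (there _) ()

NC-nonempty : ∀ {n P} → IsNCPartition n P → P ≢ []
NC-nonempty {suc n} nc refl with () ← covers (IsNCPartition⇒NCOn nc) (here refl)

leftWord-NC : ∀ {n P} → IsNCPartition n P → leftWord P ≡ P ∷ []
leftWord-NC {P = []}    nc = ⊥-elim (NC-nonempty nc refl)
leftWord-NC {P = B ∷ P} nc = cong (_∷ []) (st-range (IsNCPartition⇒NCOn nc))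

splits-interleaving : ∀ {A : Set} (xs : List A) → All (λ t → Interleaving (proj₁ t) (proj₂ t) xs) (splits xs)
splits-interleaving []       = [] ∷ []
splits-interleaving (x ∷ xs) = AllP.concat⁺ (AllP.map⁺ (All.map (λ i → consˡ i ∷ consʳ i ∷ []) (splits-interleaving xs)))

module Linear {c ℓ} (K : CommutativeRing c ℓ) where
  open Lin K
  open CommutativeRing K using (_≈_; _+_; _*_; -_; 0#; 1#; +-cong; *-cong; +-congˡ; +-congʳ; *-congˡ; *-congʳ;
    +-identityˡ; +-identityʳ; *-identityˡ; *-identityʳ; +-assoc; *-assoc; *-comm; distribˡ;
    zeroˡ; zeroʳ; -‿cong; -‿inverseˡ; setoid; ring; +-commutativeSemigroup; *-commutativeSemigroup)
    renaming (Carrier to 𝕂; refl to ≈-refl; sym to ≈-sym; trans to ≈-trans; reflexive to ≈-reflexive)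
  open RingProperties ring using (-1*x≈-x)
  open CommutativeSemigroupProperties +-commutativeSemigroup using () renaming (interchange to +-interchange)
  open CommutativeSemigroupProperties *-commutativeSemigroup using () renaming (x∙yz≈y∙xz to *-swap)
  open import Relation.Binary.Reasoning.Setoid setoid

  private variable
    X Y : Set

  -- Pairing a formal sum with a function on the basis

  eval : (X → 𝕂) → FSum X → 𝕂
  eval f []            = 0#
  eval f ((k , b) ∷ x) = k * f b + eval f x

  infix 4 _≋_
  _≋_ : FSum X → FSum X → Set _
  x ≋ y = ∀ f → eval f x ≈ eval f y

  eval-cong-All : ∀ {f g : X → 𝕂} {x} → All (λ t → f (proj₂ t) ≈ g (proj₂ t)) x → eval f x ≈ eval g x
  eval-cong-All []       = ≈-refl
  eval-cong-All (e ∷ es) = +-cong (*-congˡ e) (eval-cong-All es)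

  eval-cong : ∀ {f g : X → 𝕂} x → (∀ b → f b ≈ g b) → eval f x ≈ eval g x
  eval-cong x e = eval-cong-All (All.universal (λ _ → e _) x)

  eval-++ : ∀ {f : X → 𝕂} x y → eval f (x ++ y) ≈ eval f x + eval f y
  eval-++ []            y = ≈-sym (+-identityˡ _)
  eval-++ ((k , b) ∷ x) y = ≈-trans (+-congˡ (eval-++ x y)) (≈-sym (+-assoc _ _ _))

  -- The map `g` is specified by an equation, rather than written out, so that the lemma applies to
  -- each of the pattern-matching lambdas in the definitions of the products and tensor maps.
  eval-map : ∀ {f : Y → 𝕂} {g : 𝕂 × X → 𝕂 × Y} (F : X → Y) k x → (∀ k′ b → g (k′ , b) ≡ (k * k′ , F b)) →
             eval f (map g x) ≈ k * eval (f ∘ F) x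
  eval-map F k []             e = ≈-sym (zeroʳ k)
  eval-map {f = f} F k ((k′ , b) ∷ x) e rewrite e k′ b =
    ≈-trans (+-cong (*-assoc k k′ (f (F b))) (eval-map F k x e)) (≈-sym (distribˡ k _ _))

  eval-scale : ∀ {f : X → 𝕂} k x → eval f (scale k x) ≈ k * eval f x
  eval-scale k x = eval-map id k x λ _ _ → refl

  eval-concatMap : ∀ {f : Y → 𝕂} {g : 𝕂 × X → FSum Y} (h : X → 𝕂) x →
                   (∀ k b → eval f (g (k , b)) ≈ k * h b) → eval f (concatMap g x) ≈ eval h x
  eval-concatMap h []            e = ≈-refl
  eval-concatMap {g = g} h ((k , b) ∷ x) e =
    ≈-trans (eval-++ (g (k , b)) _) (+-cong (e k b) (eval-concatMap h x e))

  eval-0 : ∀ (x : FSum X) → eval (λ _ → 0#) x ≈ 0#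
  eval-0 []            = ≈-refl
  eval-0 ((k , b) ∷ x) = ≈-trans (+-cong (zeroʳ k) (eval-0 x)) (+-identityˡ 0#)

  eval-+ : ∀ {f g : X → 𝕂} x → eval (λ b → f b + g b) x ≈ eval f x + eval g x
  eval-+ []            = ≈-sym (+-identityˡ 0#)
  eval-+ ((k , b) ∷ x) = ≈-trans (+-cong (distribˡ k _ _) (eval-+ x)) (+-interchange _ _ _ _)

  eval-*ˡ : ∀ {f : X → 𝕂} k x → eval (λ b → k * f b) x ≈ k * eval f x
  eval-*ˡ k []             = ≈-sym (zeroʳ k)
  eval-*ˡ k ((k′ , b) ∷ x) = ≈-trans (+-cong (*-swap k′ k _) (eval-*ˡ k x)) (≈-sym (distribˡ k _ _))

  eval-swap : ∀ {h : X → Y → 𝕂} x y →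
              eval (λ a → eval (λ b → h a b) y) x ≈ eval (λ b → eval (λ a → h a b) x) y
  eval-swap []            y = ≈-sym (eval-0 y)
  eval-swap ((k , a) ∷ x) y =
    ≈-trans (+-cong (≈-sym (eval-*ˡ k y)) (eval-swap x y)) (≈-sym (eval-+ y))

  eval-single : ∀ (f : X → 𝕂) k b → eval f ((k , b) ∷ []) ≈ k * f b
  eval-single f k b = +-identityʳ _

  eval-basis : ∀ (f : X → 𝕂) b → eval f ((1# , b) ∷ []) ≈ f b
  eval-basis f b = ≈-trans (eval-single f 1# b) (*-identityˡ _)

  -- A coefficient is the pairing with an indicator function, so equality under all pairings implies
  -- coefficientwise equality.
  coeff≈eval : ∀ (d : DecidableEquality X) x b →
               coeff d x b ≈ eval (λ y → if does (d y b) then 1# else 0#) x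
  coeff≈eval d []            b = ≈-refl
  coeff≈eval d ((k , y) ∷ x) b with does (d y b)
  ... | true  = +-cong (≈-sym (*-identityʳ k)) (coeff≈eval d x b)
  ... | false = ≈-trans (coeff≈eval d x b) (≈-trans (≈-sym (+-identityˡ _)) (+-congʳ (≈-sym (zeroʳ k))))

  ≋⇒coeff : ∀ (d : DecidableEquality X) x y → x ≋ y → ∀ b → coeff d x b ≈ coeff d y b
  ≋⇒coeff d x y e b = ≈-trans (coeff≈eval d x b) (≈-trans (e _) (≈-sym (coeff≈eval d y b)))

  -- Products

  infixr 6 _·_
  _·_ : Word × Word → Word × Word → Word × Word
  (a , b) · (a′ , b′) = a ++ a′ , b ++ b′

  eval-mulT : ∀ {f} x y → eval f (mulT x y) ≈ eval (λ a → eval (λ b → f (a ++ b)) y) x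
  eval-mulT x y = eval-concatMap _ x λ k a → eval-map (a ++_) k y λ _ _ → refl

  eval-mulT2 : ∀ {f} x y → eval f (mulT2 x y) ≈ eval (λ t → eval (λ t′ → f (t · t′)) y) x
  eval-mulT2 x y = eval-concatMap _ x λ k t → eval-map (t ·_) k y λ _ _ → refl

  -- The Sweedler sum of `f` over the two tensor factors of the coproduct of `w`.
  E : Word → (Word × Word → 𝕂) → 𝕂
  E w f = eval f (Δw w)

  ·-assoc : ∀ t t′ t″ → (t · t′) · t″ ≡ t · t′ · t″
  ·-assoc (a , b) (a′ , b′) (a″ , b″) = cong₂ _,_ (++-assoc a a′ a″) (++-assoc b b′ b″)

  ·-identityʳ : ∀ t → t · ([] , []) ≡ t
  ·-identityʳ (a , b) = cong₂ _,_ (++-identityʳ a) (++-identityʳ b)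

  -- `Δw` is defined letter by letter as a product, so multiplicativity reduces to associativity of
  -- `_·_`.
  E-++ : ∀ {f} u v → E (u ++ v) f ≈ E u (λ t → E v (λ t′ → f (t · t′)))
  E-++ {f} []      v = ≈-sym (eval-basis (λ t → E v (λ t′ → f (t · t′))) _)
  E-++ {f} (L ∷ u) v = begin
    E (L ∷ u ++ v) f
      ≈⟨ eval-mulT2 (ΔL L) _ ⟩
    eval (λ t → E (u ++ v) (λ t′ → f (t · t′))) (ΔL L)
      ≈⟨ eval-cong (ΔL L) (λ t → E-++ u v) ⟩
    eval (λ t → E u (λ t′ → E v (λ t″ → f (t · t′ · t″)))) (ΔL L)
      ≈⟨ eval-cong (ΔL L) (λ t → eval-cong (Δw u) λ t′ → eval-cong (Δw v) λ t″ →
           ≈-reflexive (cong f (·-assoc t t′ t″))) ⟨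
    eval (λ t → E u (λ t′ → E v (λ t″ → f ((t · t′) · t″)))) (ΔL L)
      ≈⟨ eval-mulT2 (ΔL L) _ ⟨
    E (L ∷ u) (λ t → E v (λ t′ → f (t · t′))) ∎

  E-letter : ∀ {f} L → E (L ∷ []) f ≈ eval f (ΔL L)
  E-letter {f} L = ≈-trans (eval-mulT2 (ΔL L) _) (eval-cong (ΔL L) λ t →
    ≈-trans (eval-basis (λ t′ → f (t · t′)) _) (≈-reflexive (cong f (·-identityʳ t))))

  eval-Δ : ∀ {f} x → eval f (Δ x) ≈ eval (λ w → E w f) x
  eval-Δ x = eval-concatMap _ x λ k w → eval-scale k (Δw w)

  -- Sums over all splittings of a list of blocks

  sumS : Partition → (Partition → Partition → 𝕂) → 𝕂
  sumS []      h = h [] []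
  sumS (B ∷ P) h = sumS P λ Q U → h (B ∷ Q) U + h Q (B ∷ U)

  sumS-cong : ∀ {h h′} P → (∀ {Q U} → Interleaving Q U P → h Q U ≈ h′ Q U) → sumS P h ≈ sumS P h′
  sumS-cong []      e = e []
  sumS-cong (B ∷ P) e = sumS-cong P λ i → +-cong (e (consˡ i)) (e (consʳ i))

  sumS-+ : ∀ {h h′} P → sumS P (λ Q U → h Q U + h′ Q U) ≈ sumS P h + sumS P h′
  sumS-+ []      = ≈-refl
  sumS-+ (B ∷ P) = ≈-trans (sumS-cong P λ _ → +-interchange _ _ _ _) (sumS-+ P)

  sumS-0 : ∀ P → sumS P (λ _ _ → 0#) ≈ 0#
  sumS-0 []      = ≈-refl
  sumS-0 (B ∷ P) = ≈-trans (sumS-cong P λ _ → +-identityˡ 0#) (sumS-0 P)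

  sumS-map : ∀ h (f : Block → Block) P → sumS (map f P) h ≡ sumS P (λ Q U → h (map f Q) (map f U))
  sumS-map h f []      = refl
  sumS-map h f (B ∷ P) = sumS-map _ f P

  sumS-++ : ∀ {h} P P′ → sumS (P ++ P′) h ≈ sumS P (λ Q U → sumS P′ (λ Q′ U′ → h (Q ++ Q′) (U ++ U′)))
  sumS-++ []      P′ = ≈-refl
  sumS-++ (B ∷ P) P′ = ≈-trans (sumS-++ P P′) (sumS-cong P λ _ → sumS-+ P′)

  -- Both sides run over all ways of giving each block of `P` to one of three parts.
  sumS-assoc : ∀ {h : Partition → Partition → Partition → 𝕂} P →
               sumS P (λ Q U → sumS Q (λ Q₁ Q₂ → h Q₁ Q₂ U)) ≈ sumS P (λ Q₁ V → sumS V (λ Q₂ U → h Q₁ Q₂ U))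
  sumS-assoc []      = ≈-refl
  sumS-assoc {h} (B ∷ P) = begin
    sumS P (λ Q U → sumS Q (λ Q₁ Q₂ → h (B ∷ Q₁) Q₂ U + h Q₁ (B ∷ Q₂) U) + sumS Q (λ Q₁ Q₂ → h Q₁ Q₂ (B ∷ U)))
      ≈⟨ sumS-cong P (λ {Q} _ → ≈-trans (+-congʳ (sumS-+ Q)) (+-assoc _ _ _)) ⟩
    sumS P (λ Q U → sumS Q (λ Q₁ Q₂ → h (B ∷ Q₁) Q₂ U) +
                    (sumS Q (λ Q₁ Q₂ → h Q₁ (B ∷ Q₂) U) + sumS Q (λ Q₁ Q₂ → h Q₁ Q₂ (B ∷ U))))
      ≈⟨ ≈-trans (sumS-+ P) (+-congˡ (sumS-+ P)) ⟩
    _ ≈⟨ +-cong (sumS-assoc P) (+-cong (sumS-assoc P) (sumS-assoc P)) ⟩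
    _ ≈⟨ ≈-trans (sumS-+ P) (+-congˡ (sumS-+ P)) ⟨
    sumS P (λ Q₁ V → sumS V (λ Q₂ U → h (B ∷ Q₁) Q₂ U) +
                     (sumS V (λ Q₂ U → h Q₁ (B ∷ Q₂) U) + sumS V (λ Q₂ U → h Q₁ Q₂ (B ∷ U))))
      ≈⟨ sumS-cong P (λ {_} {V} _ → +-congˡ (sumS-+ V)) ⟨
    _ ∎

  sumS-onlyˡ : ∀ {h} P → (∀ {Q U} → Interleaving Q U P → Q ≢ [] → h Q U ≈ 0#) → sumS P h ≈ h [] P
  sumS-onlyˡ []      e = ≈-refl
  sumS-onlyˡ (B ∷ P) e = ≈-trans
    (sumS-cong P λ i → ≈-trans (+-congʳ (e (consˡ i) λ ())) (+-identityˡ _))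
    (sumS-onlyˡ P λ i → e (consʳ i))

  sumS-onlyʳ : ∀ {h} P → (∀ {Q U} → Interleaving Q U P → U ≢ [] → h Q U ≈ 0#) → sumS P h ≈ h P []
  sumS-onlyʳ []      e = ≈-refl
  sumS-onlyʳ (B ∷ P) e = ≈-trans
    (sumS-cong P λ i → ≈-trans (+-congˡ (e (consʳ i) λ ())) (+-identityʳ _))
    (sumS-onlyʳ P λ i → e (consˡ i))

  ind : Bool → 𝕂 → 𝕂
  ind b k = if b then k else 0#

  ind-cong : ∀ {b b′ k k′} → b ≡ b′ → (b ≡ true → k ≈ k′) → ind b k ≈ ind b′ k′
  ind-cong {true}  refl e = e refl
  ind-cong {false} refl e = ≈-refl

  ind-∧ : ∀ a {b k} → ind a (ind b k) ≈ ind (a ∧ b) k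
  ind-∧ true  = ≈-refl
  ind-∧ false = ≈-refl

  ind-sumS : ∀ b {h} P → ind b (sumS P h) ≈ sumS P (λ Q U → ind b (h Q U))
  ind-sumS true  P = ≈-refl
  ind-sumS false P = ≈-sym (sumS-0 P)

  sumL : (X → 𝕂) → List X → 𝕂
  sumL f []       = 0#
  sumL f (x ∷ xs) = f x + sumL f xs

  sumL-splits : ∀ h P → sumL h (splits P) ≈ sumS P (λ Q U → h (Q , U))
  sumL-splits h []      = +-identityʳ _
  sumL-splits h (B ∷ P) = ≈-trans (pair (splits P)) (sumL-splits _ P)
    where
    pair : ∀ ts → sumL h (concatMap (λ { (q , u) → (B ∷ q , u) ∷ (q , B ∷ u) ∷ [] }) ts) ≈
                  sumL (λ { (q , u) → h (B ∷ q , u) + h (q , B ∷ u) }) ts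
    pair []       = ≈-refl
    pair (t ∷ ts) = ≈-trans (+-congˡ (+-congˡ (pair ts))) (≈-sym (+-assoc _ _ _))

  eval-ΔL : ∀ {f} L → eval f (ΔL L) ≈
            sumS L (λ Q U → ind (admissibleᵇ Q U) (f (leftWord Q , rightWord (degP L) Q U)))
  eval-ΔL {f} L = ≈-trans (terms (splits L)) (sumL-splits _ L)
    where
    term : Partition × Partition → List (Word × Word)
    term (Q , U) = if admissibleᵇ Q U then (leftWord Q , rightWord (degP L) Q U) ∷ [] else []
    terms : ∀ ts → eval f (map (1# ,_) (concatMap term ts)) ≈
            sumL (λ { (Q , U) → ind (admissibleᵇ Q U) (f (leftWord Q , rightWord (degP L) Q U)) }) ts
    terms []             = ≈-refl
    terms ((Q , U) ∷ ts) with admissibleᵇ Q U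
    ... | true  = +-cong (*-identityˡ _) (terms ts)
    ... | false = ≈-trans (terms ts) (≈-sym (+-identityˡ _))

  -- Coproducts of a standardized partition and of a word of pieces

  -- Splittings, admissibility and both words are invariant under the increasing map `rank S`, so
  -- the coproduct of `st P` can be read off from `P` itself. The empty partition is included, so
  -- that empty pieces need no separate treatment later.
  E-leftWord : ∀ {S P g} → NCOn S P → E (leftWord P) g ≈
               sumS P (λ Q U → ind (admissibleᵇ Q U) (g (leftWord Q , innerWord S Q U)))
  E-leftWord {[]}    {[]} {g} nc = eval-basis g _
  E-leftWord {_ ∷ _} {[]} nc with () ← covers nc (here refl)
  E-leftWord {S} {P@(_ ∷ _)} {g} nc = begin
    E (st P ∷ []) g           ≈⟨ E-letter (st P) ⟩
    eval g (ΔL (st P))        ≈⟨ eval-ΔL (st P) ⟩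
    sumS (st P) (term (degP (st P)))
      ≈⟨ ≈-reflexive (cong₂ (λ n L → sumS L (term n)) (degP-NC (st-NC nc)) (st≡stRel nc)) ⟩
    sumS (relabel φ P) (term n) ≈⟨ ≈-reflexive (sumS-map (term n) (map φ) P) ⟩
    sumS P (λ Q U → term n (relabel φ Q) (relabel φ U)) ≈⟨ sumS-cong P same ⟩
    sumS P (λ Q U → ind (admissibleᵇ Q U) (g (leftWord Q , innerWord S Q U))) ∎
    where
    φ = rank S
    -- This is `length S`, kept in the form in which `degP-NC` gives the degree of `st P`.
    n = length (range (length S))
    open Relabel (rank-mono S)
    term : ℕ → Partition → Partition → 𝕂
    term m Q U = ind (admissibleᵇ Q U) (g (leftWord Q , rightWord m Q U))
    ncφ : NCOn (range n) (relabel φ P)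
    ncφ = subst₂ NCOn (cong range (sym (length-range (length S)))) (st≡stRel nc) (st-NC nc)
    same : ∀ {Q U} → Interleaving Q U P →
           term n (relabel φ Q) (relabel φ U) ≈ ind (admissibleᵇ Q U) (g (leftWord Q , innerWord S Q U))
    same {Q} {U} i = ind-cong (adm-map {Q} {U} Q⊆ U⊆) λ e → ≈-reflexive (cong g (cong₂ _,_ (leftWord-map {Q} Q⊆)
      (trans (rightWord≡innerWord ncφ (interleaving-map (map φ) i) (adm⁻ (relabel φ Q) (relabel φ U) e))
      (trans (cong (λ R → innerWord R (relabel φ Q) (relabel φ U))
                 (trans (cong range (length-range (length S))) (sym (map-rank (sorted nc)))))
               (innerWord-map {Q} {U} (rank-mono S) Q⊆ U⊆)))))
      where
      Q⊆ : ∀ {x} → x ∈ concat Q → x ∈ S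
      Q⊆ x∈ = within nc (Sub.lookup (concat-⊑ (interleaving-⊑ˡ i)) x∈)
      U⊆ : ∀ {x} → x ∈ concat U → x ∈ S
      U⊆ x∈ = within nc (Sub.lookup (concat-⊑ (interleaving-⊑ʳ i)) x∈)

  outerWords innerWords : List (List ℕ) → Partition → Partition → Word
  outerWords Js Q U = concatMap (λ J → leftWord (restr Q J)) Js
  innerWords Js Q U = concatMap (λ J → innerWord J (restr Q J) (restr U J)) Js

  -- Splittings of `V₁ ++ V₂` are pairs of splittings. Since nothing nests across the two parts, the
  -- product of their admissibility conditions is the condition for the whole.
  E-pieces : ∀ {Js V g} → Decomp Js V → E (concatMap (λ J → leftWord (restr V J)) Js) g ≈
             sumS V (λ Q U → ind (admissibleᵇ Q U) (g (outerWords Js Q U , innerWords Js Q U)))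
  E-pieces {g = g} [] = eval-basis g _
  E-pieces {g = g} (cons {J} {Js} {V₁} {V₂} nc D V₁∉Js V₂∉J adm₁₂ adm₂₁) = begin
    E (leftWord (restr (V₁ ++ V₂) J) ++ concatMap (λ K → leftWord (restr (V₁ ++ V₂) K)) Js) g
      ≈⟨ ≈-reflexive (cong (λ w → E w g) (cong₂ _++_ (cong leftWord (restr-++ˡ J V₁∈J V₂∉J))
           (concatMap-cong-∈ Js λ {K} K∈ → cong leftWord (restr-++ʳ K λ B∈ → V₁∉Js B∈ K∈)))) ⟩
    E (leftWord V₁ ++ concatMap (λ K → leftWord (restr V₂ K)) Js) g
      ≈⟨ E-++ (leftWord V₁) _ ⟩
    E (leftWord V₁) (λ t → E (concatMap (λ K → leftWord (restr V₂ K)) Js) (λ t′ → g (t · t′)))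
      ≈⟨ eval-cong (Δw (leftWord V₁)) (λ t → E-pieces D) ⟩
    E (leftWord V₁) (λ t → sumS V₂ (λ Q₂ U₂ → ind (admissibleᵇ Q₂ U₂)
                       (g (t · (outerWords Js Q₂ U₂ , innerWords Js Q₂ U₂)))))
      ≈⟨ E-leftWord nc ⟩
    sumS V₁ (λ Q₁ U₁ → ind (admissibleᵇ Q₁ U₁) (sumS V₂ (λ Q₂ U₂ → ind (admissibleᵇ Q₂ U₂)
              (g ((leftWord Q₁ , innerWord J Q₁ U₁) · (outerWords Js Q₂ U₂ , innerWords Js Q₂ U₂))))))
      ≈⟨ sumS-cong V₁ (λ {Q₁} {U₁} i → ≈-trans (ind-sumS (admissibleᵇ Q₁ U₁) V₂)
           (sumS-cong V₂ (λ {Q₂} {U₂} j → ≈-trans (ind-∧ (admissibleᵇ Q₁ U₁)) (same i j)))) ⟩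
    sumS V₁ (λ Q₁ U₁ → sumS V₂ (λ Q₂ U₂ → ind (admissibleᵇ (Q₁ ++ Q₂) (U₁ ++ U₂))
              (g (outerWords (J ∷ Js) (Q₁ ++ Q₂) (U₁ ++ U₂) , innerWords (J ∷ Js) (Q₁ ++ Q₂) (U₁ ++ U₂)))))
      ≈⟨ sumS-++ V₁ V₂ ⟨
    sumS (V₁ ++ V₂) (λ Q U → ind (admissibleᵇ Q U) (g (outerWords (J ∷ Js) Q U , innerWords (J ∷ Js) Q U))) ∎
    where
    V₁∈J : ∀ {B} → B ∈ V₁ → subᵇ J B ≡ true
    V₁∈J B∈ = sub⁺ J _ (block-⊆ nc B∈)
    same : ∀ {Q₁ U₁ Q₂ U₂} → Interleaving Q₁ U₁ V₁ → Interleaving Q₂ U₂ V₂ →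
           ind (admissibleᵇ Q₁ U₁ ∧ admissibleᵇ Q₂ U₂)
             (g ((leftWord Q₁ , innerWord J Q₁ U₁) · (outerWords Js Q₂ U₂ , innerWords Js Q₂ U₂))) ≈
           ind (admissibleᵇ (Q₁ ++ Q₂) (U₁ ++ U₂))
             (g (outerWords (J ∷ Js) (Q₁ ++ Q₂) (U₁ ++ U₂) , innerWords (J ∷ Js) (Q₁ ++ Q₂) (U₁ ++ U₂)))
    same {Q₁} {U₁} {Q₂} {U₂} i j = ind-cong
      (sym (adm-++ Q₁ U₁ Q₂ U₂ (λ B∈ C∈ → adm₁₂ (Q₁⊆ B∈) (U₂⊆ C∈)) (λ B∈ C∈ → adm₂₁ (Q₂⊆ B∈) (U₁⊆ C∈))))
      λ _ → ≈-reflexive (sym (cong g (cong₂ _,_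
        (cong₂ _++_ (cong leftWord Q-head) (concatMap-cong-∈ Js λ K∈ → cong leftWord (Q-tail K∈)))
        (cong₂ _++_ (cong₂ (innerWord J) Q-head U-head)
          (concatMap-cong-∈ Js λ {K} K∈ → cong₂ (innerWord K) (Q-tail K∈) (U-tail K∈))))))
      where
      Q₁⊆ : ∀ {B} → B ∈ Q₁ → B ∈ V₁
      Q₁⊆ = Sub.lookup (interleaving-⊑ˡ i)
      U₁⊆ : ∀ {B} → B ∈ U₁ → B ∈ V₁
      U₁⊆ = Sub.lookup (interleaving-⊑ʳ i)
      Q₂⊆ : ∀ {B} → B ∈ Q₂ → B ∈ V₂
      Q₂⊆ = Sub.lookup (interleaving-⊑ˡ j)
      U₂⊆ : ∀ {B} → B ∈ U₂ → B ∈ V₂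
      U₂⊆ = Sub.lookup (interleaving-⊑ʳ j)
      Q-head : restr (Q₁ ++ Q₂) J ≡ Q₁
      Q-head = restr-++ˡ J (V₁∈J ∘ Q₁⊆) (V₂∉J ∘ Q₂⊆)
      U-head : restr (U₁ ++ U₂) J ≡ U₁
      U-head = restr-++ˡ J (V₁∈J ∘ U₁⊆) (V₂∉J ∘ U₂⊆)
      Q-tail : ∀ {K} → K ∈ Js → restr (Q₁ ++ Q₂) K ≡ restr Q₂ K
      Q-tail {K} K∈ = restr-++ʳ K λ B∈ → V₁∉Js (Q₁⊆ B∈) K∈
      U-tail : ∀ {K} → K ∈ Js → restr (U₁ ++ U₂) K ≡ restr U₂ K
      U-tail {K} K∈ = restr-++ʳ K λ B∈ → V₁∉Js (U₁⊆ B∈) K∈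

  -- Coassociativity

  ΔΔˡ ΔΔʳ : Word → (Word → Word → Word → 𝕂) → 𝕂
  ΔΔˡ w f = E w λ { (a , b) → E a λ { (a₁ , a₂) → f a₁ a₂ b } }
  ΔΔʳ w f = E w λ { (a , b) → E b λ { (b₁ , b₂) → f a b₁ b₂ } }

  coassoc-leftWord : ∀ {S P f} → NCOn S P → ΔΔˡ (leftWord P) f ≈ ΔΔʳ (leftWord P) f
  coassoc-leftWord {S} {P} {f} nc = begin
    ΔΔˡ (leftWord P) f ≈⟨ E-leftWord nc ⟩
    sumS P (λ Q U → ind (admissibleᵇ Q U) (E (leftWord Q) λ { (a₁ , a₂) → f a₁ a₂ (innerWord S Q U) }))
      ≈⟨ sumS-cong P left ⟩
    sumS P (λ Q U → sumS Q (λ Q₁ Q₂ → triple Q₁ Q₂ U)) ≈⟨ sumS-assoc P ⟩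
    sumS P (λ Q₁ V → sumS V (λ Q₂ U → triple Q₁ Q₂ U)) ≈⟨ sumS-cong P right ⟨
    sumS P (λ Q₁ V → ind (admissibleᵇ Q₁ V) (E (innerWord S Q₁ V) λ { (b₁ , b₂) → f (leftWord Q₁) b₁ b₂ }))
      ≈⟨ E-leftWord nc ⟨
    ΔΔʳ (leftWord P) f ∎
    where
    triple : Partition → Partition → Partition → 𝕂
    value : Partition → Partition → Partition → 𝕂
    value Q₁ Q₂ U = f (leftWord Q₁) (outerWords (pieces (inQ Q₁) S) Q₂ U) (innerWords (pieces (inQ Q₁) S) Q₂ U)
    -- The condition is spelled out on pairs of parts. Its bracketing is the one that arises from
    -- splitting `V`; `∧-rotate` brings the one from splitting `Q` into this form.
    triple Q₁ Q₂ U = ind ((admissibleᵇ Q₁ Q₂ ∧ admissibleᵇ Q₁ U) ∧ admissibleᵇ Q₂ U) (value Q₁ Q₂ U)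
    ∧-rotate : ∀ a b c → (a ∧ b) ∧ c ≡ (c ∧ a) ∧ b
    ∧-rotate true  true  true  = refl
    ∧-rotate true  true  false = refl
    ∧-rotate true  false true  = refl
    ∧-rotate true  false false = refl
    ∧-rotate false b     true  = refl
    ∧-rotate false b     false = refl
    left : ∀ {Q U} → Interleaving Q U P →
           ind (admissibleᵇ Q U) (E (leftWord Q) λ { (a₁ , a₂) → f a₁ a₂ (innerWord S Q U) }) ≈
           sumS Q (λ Q₁ Q₂ → triple Q₁ Q₂ U)
    left {Q} {U} i = ≈-trans
      (ind-cong {admissibleᵇ Q U} refl λ _ → E-leftWord (interleaving-NCˡ nc i))
      (≈-trans (ind-sumS (admissibleᵇ Q U) Q) (sumS-cong Q λ {Q₁} {Q₂} j →
        ≈-trans (ind-∧ (admissibleᵇ Q U) {admissibleᵇ Q₁ Q₂}) (≈-sym (ind-cong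
          (trans (sym (∧-rotate (admissibleᵇ Q₁ U) (admissibleᵇ Q₂ U) (admissibleᵇ Q₁ Q₂)))
                   (cong (_∧ admissibleᵇ Q₁ Q₂) (sym (adm-interleavingˡ {U = U} j))))
          λ e → let e₁₂ , _ = ∧-true⁻ e ; e₁ , e₂ = ∧-true⁻ e₁₂ in
            ≈-reflexive (sym (cong₂ (f (leftWord Q₁)) (innerWord-middle nc i j)
              (innerWord-inner nc i j (adm⁻ Q₁ Q₂ e₁) (adm⁻ Q₁ U e₂))))))))
    right : ∀ {Q₁ V} → Interleaving Q₁ V P →
            ind (admissibleᵇ Q₁ V) (E (innerWord S Q₁ V) λ { (b₁ , b₂) → f (leftWord Q₁) b₁ b₂ }) ≈
            sumS V (λ Q₂ U → triple Q₁ Q₂ U)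
    right {Q₁} {V} i = ≈-trans
      (ind-cong {admissibleᵇ Q₁ V} refl λ e → E-pieces (pieces-decomp nc i (adm⁻ Q₁ V e)))
      (≈-trans (ind-sumS (admissibleᵇ Q₁ V) V) (sumS-cong V λ {Q₂} {U} j →
        ≈-trans (ind-∧ (admissibleᵇ Q₁ V) {admissibleᵇ Q₂ U} {value Q₁ Q₂ U})
          (≈-reflexive (cong (λ b → ind (b ∧ admissibleᵇ Q₂ U) (value Q₁ Q₂ U)) (adm-interleavingʳ {Q = Q₁} j)))))

  -- Both iterated coproducts are multiplicative, so the claim reduces to single letters. The
  -- exchanges by `eval-swap` move the sum over the coproduct of the tail past the second coproduct
  -- of the head, separating the two factors.
  coassoc-word : ∀ {w} → ValidWord w → ∀ f → ΔΔˡ w f ≈ ΔΔʳ w f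
  coassoc-word []                     f = ≈-refl
  coassoc-word {L ∷ w} ((n , nc) ∷ v) f = begin
    ΔΔˡ (L ∷ w) f
      ≈⟨ E-++ (L ∷ []) w ⟩
    E (L ∷ []) (λ { (a , b) → E w λ { (a′ , b′) → E (a ++ a′) λ { (c₁ , c₂) → f c₁ c₂ (b ++ b′) } } })
      ≈⟨ eval-cong (Δw (L ∷ [])) (λ { (a , b) → eval-cong (Δw w) λ { (a′ , b′) → E-++ a a′ } }) ⟩
    E (L ∷ []) (λ { (a , b) → E w λ { (a′ , b′) → E a λ { (c₁ , c₂) → E a′ λ { (c₁′ , c₂′) →
      f (c₁ ++ c₁′) (c₂ ++ c₂′) (b ++ b′) } } } })
      ≈⟨ eval-cong (Δw (L ∷ [])) (λ { (a , b) → eval-swap (Δw w) (Δw a) }) ⟩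
    ΔΔˡ (L ∷ []) (λ c₁ c₂ b → ΔΔˡ w (λ c₁′ c₂′ b′ → f (c₁ ++ c₁′) (c₂ ++ c₂′) (b ++ b′)))
      ≈⟨ eval-cong (Δw (L ∷ [])) (λ { (a , b) → eval-cong (Δw a) λ { (c₁ , c₂) → coassoc-word v _ } }) ⟩
    ΔΔˡ (L ∷ []) (λ c₁ c₂ b → ΔΔʳ w (λ c₁′ c₂′ b′ → f (c₁ ++ c₁′) (c₂ ++ c₂′) (b ++ b′)))
      -- Standardization fixes a partition of `range n`, so the letter `L` is its own `leftWord`.
      ≈⟨ subst (λ u → ΔΔˡ u g ≈ ΔΔʳ u g) (leftWord-NC nc) (coassoc-leftWord (IsNCPartition⇒NCOn nc)) ⟩
    ΔΔʳ (L ∷ []) (λ a c₁ c₂ → ΔΔʳ w (λ a′ c₁′ c₂′ → f (a ++ a′) (c₁ ++ c₁′) (c₂ ++ c₂′)))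
      ≈⟨ eval-cong (Δw (L ∷ [])) (λ { (a , b) → eval-swap (Δw w) (Δw b) }) ⟨
    E (L ∷ []) (λ { (a , b) → E w λ { (a′ , b′) → E b λ { (c₁ , c₂) → E b′ λ { (c₁′ , c₂′) →
      f (a ++ a′) (c₁ ++ c₁′) (c₂ ++ c₂′) } } } })
      ≈⟨ eval-cong (Δw (L ∷ [])) (λ { (a , b) → eval-cong (Δw w) λ { (a′ , b′) → E-++ b b′ } }) ⟨
    E (L ∷ []) (λ { (a , b) → E w λ { (a′ , b′) → E (b ++ b′) λ { (c₁ , c₂) → f (a ++ a′) c₁ c₂ } } })
      ≈⟨ E-++ (L ∷ []) w ⟨
    ΔΔʳ (L ∷ w) f ∎
    where
    g : Word → Word → Word → 𝕂
    g a b c = ΔΔʳ w (λ a′ b′ c′ → f (a ++ a′) (b ++ b′) (c ++ c′))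

  -- Counit

  εw-++ : ∀ u v → εw (u ++ v) ≈ εw u * εw v
  εw-++ []      v = ≈-sym (*-identityˡ _)
  εw-++ (L ∷ u) v = ≈-sym (zeroˡ _)

  εw-≢[] : ∀ {w} k → w ≢ [] → εw w * k ≈ 0#
  εw-≢[] {[]}    k h = ⊥-elim (h refl)
  εw-≢[] {_ ∷ _} k h = zeroˡ k

  ind-0 : ∀ b {k} → (b ≡ true → k ≈ 0#) → ind b k ≈ 0#
  ind-0 true  e = e refl
  ind-0 false e = ≈-refl

  counitˡ-leftWord : ∀ {S P} {f : Word → 𝕂} → NCOn S P → E (leftWord P) (λ { (a , b) → εw a * f b }) ≈ f (leftWord P)
  counitˡ-leftWord {S} {P} {f} nc = begin
    E (leftWord P) _ ≈⟨ E-leftWord nc ⟩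
    sumS P (λ Q U → ind (admissibleᵇ Q U) (εw (leftWord Q) * f (innerWord S Q U)))
      ≈⟨ sumS-onlyˡ P (λ { {[]} i h → ⊥-elim (h refl) ; {B ∷ Q} {U} i h → ind-0 (admissibleᵇ (B ∷ Q) U) λ _ → zeroˡ _ }) ⟩
    1# * f (innerWord S [] P) ≈⟨ *-identityˡ _ ⟩
    f (innerWord S [] P)      ≈⟨ ≈-reflexive (cong f (innerWord-∅ˡ nc)) ⟩
    f (leftWord P) ∎

  counitʳ-leftWord : ∀ {S P} {f : Word → 𝕂} → NCOn S P → E (leftWord P) (λ { (a , b) → εw b * f a }) ≈ f (leftWord P)
  counitʳ-leftWord {S} {P} {f} nc = begin
    E (leftWord P) _ ≈⟨ E-leftWord nc ⟩
    sumS P (λ Q U → ind (admissibleᵇ Q U) (εw (innerWord S Q U) * f (leftWord Q)))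
      ≈⟨ sumS-onlyʳ P (λ {Q} {U} i h → ind-0 (admissibleᵇ Q U) λ e →
           εw-≢[] _ (innerWord-≢[] nc i (adm⁻ Q U e) h)) ⟩
    ind (admissibleᵇ P []) (εw (innerWord S P []) * f (leftWord P))
      ≈⟨ ≈-reflexive (cong₂ (λ b w → ind b (εw w * f (leftWord P))) (adm-[]ʳ P) (innerWord-∅ʳ S P)) ⟩
    1# * f (leftWord P) ≈⟨ *-identityˡ _ ⟩
    f (leftWord P) ∎

  counitˡ-word : ∀ {w} → ValidWord w → ∀ f → E w (λ { (a , b) → εw a * f b }) ≈ f w
  counitˡ-word []                     f = ≈-trans (+-identityʳ _) (≈-trans (*-identityˡ _) (*-identityˡ _))
  counitˡ-word {L ∷ w} ((n , nc) ∷ v) f = begin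
    E (L ∷ w) (λ { (a , b) → εw a * f b })
      ≈⟨ E-++ (L ∷ []) w ⟩
    E (L ∷ []) (λ { (a , b) → E w (λ { (a′ , b′) → εw (a ++ a′) * f (b ++ b′) }) })
      ≈⟨ eval-cong (Δw (L ∷ [])) (λ { (a , b) → ≈-trans
           (eval-cong (Δw w) λ { (a′ , b′) → ≈-trans (*-congʳ (εw-++ a a′)) (*-assoc _ _ _) })
           (≈-trans (eval-*ˡ (εw a) (Δw w)) (*-congˡ (counitˡ-word v λ b′ → f (b ++ b′)))) }) ⟩
    E (L ∷ []) (λ { (a , b) → εw a * f (b ++ w) })
      ≈⟨ subst (λ u → E u (λ { (a , b) → εw a * f (b ++ w) }) ≈ f (u ++ w)) (leftWord-NC nc)
           (counitˡ-leftWord {f = λ b → f (b ++ w)} (IsNCPartition⇒NCOn nc)) ⟩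
    f (L ∷ w) ∎

  counitʳ-word : ∀ {w} → ValidWord w → ∀ f → E w (λ { (a , b) → εw b * f a }) ≈ f w
  counitʳ-word []                     f = ≈-trans (+-identityʳ _) (≈-trans (*-identityˡ _) (*-identityˡ _))
  counitʳ-word {L ∷ w} ((n , nc) ∷ v) f = begin
    E (L ∷ w) (λ { (a , b) → εw b * f a })
      ≈⟨ E-++ (L ∷ []) w ⟩
    E (L ∷ []) (λ { (a , b) → E w (λ { (a′ , b′) → εw (b ++ b′) * f (a ++ a′) }) })
      ≈⟨ eval-cong (Δw (L ∷ [])) (λ { (a , b) → ≈-trans
           (eval-cong (Δw w) λ { (a′ , b′) → ≈-trans (*-congʳ (εw-++ b b′)) (*-assoc _ _ _) })
           (≈-trans (eval-*ˡ (εw b) (Δw w)) (*-congˡ (counitʳ-word v λ a′ → f (a ++ a′)))) }) ⟩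
    E (L ∷ []) (λ { (a , b) → εw b * f (a ++ w) })
      ≈⟨ subst (λ u → E u (λ { (a , b) → εw b * f (a ++ w) }) ≈ f (u ++ w)) (leftWord-NC nc)
           (counitʳ-leftWord {f = λ a → f (a ++ w)} (IsNCPartition⇒NCOn nc)) ⟩
    f (L ∷ w) ∎

  -- Validity and degrees of the terms of the coproduct

  record Good (w : Word) (t : Word × Word) : Set where
    constructor good
    field
      validˡ : ValidWord (proj₁ t)
      validʳ : ValidWord (proj₂ t)
      degree : degW (proj₁ t) +ℕ degW (proj₂ t) ≡ degW w
  open Good

  All-concatMap : ∀ {a b p} {A : Set a} {B : Set b} {P : B → Set p} {f : A → List B} {xs} →
                  All (λ x → All P (f x)) xs → All P (concatMap f xs)
  All-concatMap ps = AllP.concat⁺ (AllP.map⁺ ps)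

  good-ΔL : ∀ {n L} → IsNCPartition n L → All (λ t → Good (L ∷ []) (proj₂ t)) (ΔL L)
  good-ΔL {n} {L} nc = AllP.map⁺ (All-concatMap (All.map term (splits-interleaving L)))
    where
    nc′ = IsNCPartition⇒NCOn nc
    deg-L : degP L ≡ n
    deg-L = trans (degP-NC nc′) (length-range n)
    term : ∀ {t : Partition × Partition} → Interleaving (proj₁ t) (proj₂ t) L →
           All (Good (L ∷ [])) (if admissibleᵇ (proj₁ t) (proj₂ t)
             then (leftWord (proj₁ t) , rightWord (degP L) (proj₁ t) (proj₂ t)) ∷ [] else [])
    term {Q , U} i with admissibleᵇ Q U in e
    ... | false = []
    ... | true  = subst (λ v → Good (L ∷ []) (leftWord Q , v))
                    (sym (trans (cong (λ m → rightWord m Q U) deg-L) (rightWord≡innerWord nc′ i adm)))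
                    (good (leftWord-valid (interleaving-NCˡ nc′ i)) (innerWord-valid nc′ i adm)
                      (trans (split-deg nc′ i adm) (sym (trans (ℕP.+-identityʳ _) (degP-NC nc′))))) ∷ []
      where
      adm : Adm Q U
      adm = adm⁻ Q U e

  good-Δw : ∀ {w} → ValidWord w → All (λ t → Good w (proj₂ t)) (Δw w)
  good-Δw []                     = good [] [] refl ∷ []
  good-Δw {L ∷ w} ((n , nc) ∷ v) = All-concatMap (All.map (λ {t} g →
    AllP.map⁺ (All.map (λ {t′} g′ → good (AllP.++⁺ (validˡ g) (validˡ g′)) (AllP.++⁺ (validʳ g) (validʳ g′))
      (degrees (proj₂ t) (proj₂ t′) g g′)) (good-Δw v))) (good-ΔL nc))
    where
    degrees : ∀ t t′ → Good (L ∷ []) t → Good w t′ →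
              degW (proj₁ (t · t′)) +ℕ degW (proj₂ (t · t′)) ≡ degW (L ∷ w)
    degrees (a , b) (a′ , b′) g g′ = trans (cong₂ _+ℕ_ (degW-++ a a′) (degW-++ b b′))
      (trans (ℕ-interchange (degW a) (degW a′) (degW b) (degW b′))
        (cong₂ _+ℕ_ (trans (degree g) (ℕP.+-identityʳ _)) (degree g′)))
      where
      open CommutativeSemigroupProperties ℕP.+-commutativeSemigroup using () renaming (interchange to ℕ-interchange)

  -- From this come both connectedness and the drop in degree that makes the antipode series locally
  -- finite.
  valid-nonzero : ∀ {L w} → ValidWord (L ∷ w) → 1 ≤ degW (L ∷ w)
  valid-nonzero {L} {w} ((n , nc) ∷ v) = ℕP.≤-trans (IsNCPartition.n≥1 nc)
    (ℕP.≤-trans (ℕP.≤-reflexive (sym (trans (degP-NC (IsNCPartition⇒NCOn nc)) (length-range n)))) (ℕP.m≤m+n _ _))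

  -- Convolution

  conv : (Word → T) → (Word → T) → Word → T
  conv F G w = concatMap (λ { (k , (a , b)) → scale k (mulT (F a) (G b)) }) (Δw w)

  eval-conv : ∀ {f} F G w → eval f (conv F G w) ≈
              E w (λ { (a , b) → eval (λ u → eval (λ v → f (u ++ v)) (G b)) (F a) })
  eval-conv F G w = eval-concatMap _ (Δw w) λ { k (a , b) →
    ≈-trans (eval-scale k (mulT (F a) (G b))) (*-congˡ (eval-mulT (F a) (G b))) }

  infix 4 _≈ᵥ_
  -- Valid words only: the associativity and unit laws of convolution come from coassociativity and
  -- the counit laws, which are established for non-crossing partitions.
  _≈ᵥ_ : (Word → T) → (Word → T) → Set _
  F ≈ᵥ G = ∀ {w} → ValidWord w → F w ≋ G w

  conv-cong-at : ∀ {F F′ G G′ w} → ValidWord w → (∀ {a b} → Good w (a , b) → F a ≋ F′ a) →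
                 (∀ {a b} → Good w (a , b) → G b ≋ G′ b) → conv F G w ≋ conv F′ G′ w
  conv-cong-at {F} {F′} {G} {G′} {w} v eF eG f = begin
    eval f (conv F G w) ≈⟨ eval-conv F G w ⟩
    _ ≈⟨ eval-cong-All (All.map (λ { {_ , a , b} g →
           ≈-trans (eF g _) (eval-cong (F′ a) λ u → eG g _) }) (good-Δw v)) ⟩
    _ ≈⟨ eval-conv F′ G′ w ⟨
    eval f (conv F′ G′ w) ∎

  conv-congˡ : ∀ F G G′ → G ≈ᵥ G′ → conv F G ≈ᵥ conv F G′
  conv-congˡ F G G′ e v = conv-cong-at {F} {F} {G} {G′} v (λ _ _ → ≈-refl) (λ g → e (validʳ g))

  conv-assoc : ∀ F G H → conv (conv F G) H ≈ᵥ conv F (conv G H)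
  conv-assoc F G H {w} v f = begin
    eval f (conv (conv F G) H w) ≈⟨ eval-conv (conv F G) H w ⟩
    _ ≈⟨ eval-cong (Δw w) (λ { (a , b) → eval-conv F G a }) ⟩
    _ ≈⟨ coassoc-word v (λ a b c → eval (λ u → eval (λ u′ → eval (λ u″ → f ((u ++ u′) ++ u″)) (H c)) (G b)) (F a)) ⟩
    _ ≈⟨ eval-cong (Δw w) (λ { (a , b) → eval-cong (Δw b) λ { (b₁ , b₂) →
           eval-cong (F a) λ u → eval-cong (G b₁) λ u′ → eval-cong (H b₂) λ u″ →
             ≈-reflexive (cong f (++-assoc u u′ u″)) } }) ⟩
    _ ≈⟨ eval-cong (Δw w) (λ { (a , b) → eval-swap (Δw b) (F a) }) ⟩
    _ ≈⟨ eval-cong (Δw w) (λ { (a , b) → eval-cong (F a) λ u → eval-conv G H b }) ⟨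
    _ ≈⟨ eval-conv F (conv G H) w ⟨
    eval f (conv F (conv G H) w) ∎

  unitT : Word → T
  unitT w = η (εw w)

  conv-unitˡ : ∀ F → conv unitT F ≈ᵥ F
  conv-unitˡ F {w} v f = begin
    eval f (conv unitT F w) ≈⟨ eval-conv unitT F w ⟩
    _ ≈⟨ eval-cong (Δw w) (λ { (a , b) → eval-single (λ u → eval (λ v → f (u ++ v)) (F b)) (εw a) [] }) ⟩
    _ ≈⟨ counitˡ-word v (λ b → eval f (F b)) ⟩
    eval f (F w) ∎

  conv-unitʳ : ∀ F → conv F unitT ≈ᵥ F
  conv-unitʳ F {w} v f = begin
    eval f (conv F unitT w) ≈⟨ eval-conv F unitT w ⟩
    _ ≈⟨ eval-cong (Δw w) (λ { (a , b) → ≈-trans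
           (eval-cong (F a) λ u → ≈-trans (eval-single (λ v → f (u ++ v)) (εw b) []) (*-congˡ (≈-reflexive (cong f (++-identityʳ u)))))
           (eval-*ˡ (εw b) (F a)) }) ⟩
    _ ≈⟨ counitʳ-word v (λ a → eval f (F a)) ⟩
    eval f (F w) ∎

  infixl 6 _⊖_
  _⊖_ : (Word → T) → (Word → T) → Word → T
  (F ⊖ G) w = F w ++ scale (- 1#) (G w)

  eval-⊖ : ∀ {f} F G w → eval f ((F ⊖ G) w) ≈ eval f (F w) + - eval f (G w)
  eval-⊖ F G w = ≈-trans (eval-++ (F w) _) (+-congˡ (≈-trans (eval-scale (- 1#) (G w)) (-1*x≈-x _)))

  eval-neg : ∀ {f : X → 𝕂} x → eval (λ b → - f b) x ≈ - eval f x
  eval-neg x = ≈-trans (eval-cong x λ _ → ≈-sym (-1*x≈-x _)) (≈-trans (eval-*ˡ (- 1#) x) (-1*x≈-x _))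

  conv-⊖ˡ : ∀ F G H → conv (F ⊖ G) H ≈ᵥ conv F H ⊖ conv G H
  conv-⊖ˡ F G H {w} v f = begin
    eval f (conv (F ⊖ G) H w) ≈⟨ eval-conv (F ⊖ G) H w ⟩
    _ ≈⟨ eval-cong (Δw w) (λ { (a , b) → eval-⊖ F G a }) ⟩
    _ ≈⟨ ≈-trans (eval-+ (Δw w)) (+-congˡ (eval-neg (Δw w))) ⟩
    _ ≈⟨ +-cong (eval-conv F H w) (-‿cong (eval-conv G H w)) ⟨
    _ ≈⟨ eval-⊖ (conv F H) (conv G H) w ⟨
    eval f ((conv F H ⊖ conv G H) w) ∎

  conv-⊖ʳ : ∀ F G H → conv F (G ⊖ H) ≈ᵥ conv F G ⊖ conv F H
  conv-⊖ʳ F G H {w} v f = begin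
    eval f (conv F (G ⊖ H) w) ≈⟨ eval-conv F (G ⊖ H) w ⟩
    _ ≈⟨ eval-cong (Δw w) (λ { (a , b) → ≈-trans (eval-cong (F a) λ u → eval-⊖ G H b)
           (≈-trans (eval-+ (F a)) (+-congˡ (eval-neg (F a)))) }) ⟩
    _ ≈⟨ ≈-trans (eval-+ (Δw w)) (+-congˡ (eval-neg (Δw w))) ⟩
    _ ≈⟨ +-cong (eval-conv F G w) (-‿cong (eval-conv F H w)) ⟨
    _ ≈⟨ eval-⊖ (conv F G) (conv F H) w ⟨
    eval f ((conv F G ⊖ conv F H) w) ∎

  ⊖-cong : ∀ (F F′ G G′ : Word → T) w → F w ≋ F′ w → G w ≋ G′ w → (F ⊖ G) w ≋ (F′ ⊖ G′) w
  ⊖-cong F F′ G G′ w e e′ f =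
    ≈-trans (eval-⊖ F G w) (≈-trans (+-cong (e f) (-‿cong (e′ f))) (≈-sym (eval-⊖ F′ G′ w)))

  -- The antipode is the geometric series Σ (−1)ᵏ π*ᵏ in the convolution powers of π = id − ηε, which is locally finite
  -- because π vanishes in degree 0. The partial sums are evaluated by Horner's rule.

  π : Word → T
  π []      = []
  π (L ∷ w) = basis (L ∷ w)

  series : ℕ → Word → T
  series zero    = unitT
  series (suc N) = unitT ⊖ conv π (series N)

  -- Truncating at the degree loses nothing: a `k`-fold convolution power of `π` vanishes on valid
  -- words of degree less than `k`.
  antipodeT : Word → T
  antipodeT w = series (degW w) w

  -- The factor `π` kills the empty word and so takes up positive degree, leaving strictly less for
  -- the other factor.
  conv-π-cong : ∀ G G′ {w} → ValidWord w → (∀ {b} → ValidWord b → degW b < degW w → G b ≋ G′ b) →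
                conv π G w ≋ conv π G′ w
  conv-π-cong G G′ {w} v e f = begin
    eval f (conv π G w) ≈⟨ eval-conv π G w ⟩
    _ ≈⟨ eval-cong-All (All.map (λ { {_ , [] , b} g → ≈-refl
         ; {_ , L ∷ a , b} g → +-congʳ (*-congˡ (e (validʳ g) (lower g) _)) }) (good-Δw v)) ⟩
    _ ≈⟨ eval-conv π G′ w ⟨
    eval f (conv π G′ w) ∎
    where
    lower : ∀ {L a b} → Good w (L ∷ a , b) → degW b < degW w
    lower {b = b} g = subst (degW b <_) (degree g) (ℕP.+-monoˡ-≤ (degW b) (valid-nonzero (validˡ g)))

  -- Each Horner step lowers the truncation index by one and the relevant degree by at least one. At
  -- truncation 0 only the empty word remains, where the convolution with `π` vanishes.
  series-stable : ∀ N M {w} → ValidWord w → degW w ≤ N → degW w ≤ M → series N w ≋ series M w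
  series-stable zero    zero    v _ _ f = ≈-refl
  series-stable (suc N) (suc M) {w} v ≤N ≤M =
    ⊖-cong unitT unitT (conv π (series N)) (conv π (series M)) w (λ _ → ≈-refl)
      (conv-π-cong (series N) (series M) v λ v′ <w → series-stable N M v′
        (ℕP.≤-pred (ℕP.≤-trans <w ≤N)) (ℕP.≤-pred (ℕP.≤-trans <w ≤M)))
  series-stable zero    (suc M) {w} v ≤N ≤M f = ≈-sym (series-zero M v ≤N f)
    where
    series-zero : ∀ M {w} → ValidWord w → degW w ≤ 0 → series (suc M) w ≋ unitT w
    series-zero M {[]}    v d f = ≈-trans (eval-⊖ {f} unitT (conv π (series M)) [])
      (≈-trans (+-congˡ (≈-trans (≈-sym (-1*x≈-x 0#)) (zeroʳ (- 1#)))) (+-identityʳ (eval f (unitT []))))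
    series-zero M {L ∷ w} v d f = ⊥-elim (ℕP.n≮0 (ℕP.≤-trans (valid-nonzero v) d))
  series-stable (suc N) zero    v ≤N ≤M f = ≈-sym (series-stable zero (suc N) v ≤M ≤N f)

  -- `series N` is a polynomial in `π`, hence commutes with it. Thus the recursion with `π` on the
  -- left serves both antipode identities.
  π-series-comm : ∀ N → conv (series N) π ≈ᵥ conv π (series N)
  π-series-comm zero    v f = ≈-trans (conv-unitˡ π v f) (≈-sym (conv-unitʳ π v f))
  π-series-comm (suc N) {w} v f = begin
    eval f (conv (unitT ⊖ conv π (series N)) π w)
      ≈⟨ conv-⊖ˡ unitT (conv π (series N)) π v f ⟩
    eval f ((conv unitT π ⊖ conv (conv π (series N)) π) w)
      ≈⟨ ⊖-cong (conv unitT π) (conv π unitT) (conv (conv π (series N)) π) (conv π (conv π (series N))) w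
           (λ g → ≈-trans (conv-unitˡ π v g) (≈-sym (conv-unitʳ π v g)))
           (λ g → ≈-trans (conv-assoc π (series N) π v g)
             (conv-congˡ π (conv (series N) π) (conv π (series N)) (π-series-comm N) v g)) f ⟩
    eval f ((conv π unitT ⊖ conv π (conv π (series N))) w)
      ≈⟨ conv-⊖ʳ π unitT (conv π (series N)) v f ⟨
    eval f (conv π (unitT ⊖ conv π (series N)) w) ∎

  eval-basis-split : ∀ {f} w → eval f (basis w) ≈ eval f (unitT w) + eval f (π w)
  eval-basis-split []      = ≈-sym (+-identityʳ _)
  eval-basis-split {f} (L ∷ w) = ≈-sym (≈-trans (+-congʳ (≈-trans (eval-single f 0# []) (zeroˡ _))) (+-identityˡ _))

  antipode-series : ∀ {N w} → ValidWord w → degW w ≤ N → antipodeT w ≋ series N w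
  antipode-series {N} {w} v d = series-stable (degW w) N v ℕP.≤-refl d

  -- Raising the truncation by one does not change the value and exposes one Horner step, whose
  -- subtracted term then cancels.
  antipode-recursion : ∀ {f w} → ValidWord w →
                       eval f (antipodeT w) + eval f (conv π (series (degW w)) w) ≈ eval f (unitT w)
  antipode-recursion {f} {w} v = begin
    eval f (antipodeT w) + tail             ≈⟨ +-congʳ (antipode-series v (ℕP.n≤1+n _) f) ⟩
    eval f (series (suc (degW w)) w) + tail ≈⟨ +-congʳ (eval-⊖ unitT (conv π (series (degW w))) w) ⟩
    (eval f (unitT w) + - tail) + tail      ≈⟨ +-assoc _ _ _ ⟩
    eval f (unitT w) + (- tail + tail)      ≈⟨ +-congˡ (-‿inverseˡ tail) ⟩
    eval f (unitT w) + 0#                 ≈⟨ +-identityʳ _ ⟩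
    eval f (unitT w) ∎
    where tail = eval f (conv π (series (degW w)) w)

  -- Writing the identity as the convolution unit plus `π` turns the left side into the antipode
  -- plus its convolution with `π`, to which the recursion applies after commuting.
  antipodeˡ : conv antipodeT basis ≈ᵥ unitT
  antipodeˡ {w} v f = begin
    eval f (conv antipodeT basis w) ≈⟨ eval-conv antipodeT basis w ⟩
    _ ≈⟨ eval-cong (Δw w) (λ { (a , b) → ≈-trans (eval-cong (antipodeT a) λ u → eval-basis-split b) (eval-+ (antipodeT a)) }) ⟩
    _ ≈⟨ eval-+ (Δw w) ⟩
    _ ≈⟨ +-cong (eval-conv antipodeT unitT w) (eval-conv antipodeT π w) ⟨
    eval f (conv antipodeT unitT w) + eval f (conv antipodeT π w)
      ≈⟨ +-cong (conv-unitʳ antipodeT v f) (≈-trans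
           -- `antipodeT` truncates at a level depending on the tensor factor `a`, while commutation
           -- needs a fixed one; `degW w` is large enough for every `a`.
           (conv-cong-at {antipodeT} {series (degW w)} {π} {π} v
             (λ {a} g → antipode-series (validˡ g) (subst (degW a ≤_) (degree g) (ℕP.m≤m+n _ _))) (λ _ _ → ≈-refl) f)
           (π-series-comm (degW w) v f)) ⟩
    eval f (antipodeT w) + eval f (conv π (series (degW w)) w) ≈⟨ antipode-recursion v ⟩
    eval f (unitT w) ∎

  antipodeʳ : conv basis antipodeT ≈ᵥ unitT
  antipodeʳ {w} v f = begin
    eval f (conv basis antipodeT w) ≈⟨ eval-conv basis antipodeT w ⟩
    _ ≈⟨ eval-cong (Δw w) (λ { (a , b) → eval-basis-split a }) ⟩
    _ ≈⟨ eval-+ (Δw w) ⟩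
    _ ≈⟨ +-cong (eval-conv unitT antipodeT w) (eval-conv π antipodeT w) ⟨
    eval f (conv unitT antipodeT w) + eval f (conv π antipodeT w)
      ≈⟨ +-cong (conv-unitˡ antipodeT v f) (conv-π-cong antipodeT (series (degW w)) v (λ v′ <w → antipode-series v′ (ℕP.<⇒≤ <w)) f) ⟩
    eval f (antipodeT w) + eval f (conv π (series (degW w)) w) ≈⟨ antipode-recursion v ⟩
    eval f (unitT w) ∎

  -- Closure under the operations

  mulT-valid : ∀ x y → ValidT x → ValidT y → ValidT (mulT x y)
  mulT-valid x y vx vy = All-concatMap (All.map (λ va → AllP.map⁺ (All.map (λ vb → AllP.++⁺ va vb) vy)) vx)

  scale-valid : ∀ k {x} → ValidT x → ValidT (scale k x)
  scale-valid k vx = AllP.map⁺ vx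

  conv-valid : ∀ {F G} → (∀ {w} → ValidWord w → ValidT (F w)) → (∀ {w} → ValidWord w → ValidT (G w)) →
               ∀ {w} → ValidWord w → ValidT (conv F G w)
  conv-valid vF vG v = All-concatMap (All.map (λ {t} g →
    scale-valid (proj₁ t) (mulT-valid _ _ (vF (validˡ g)) (vG (validʳ g)))) (good-Δw v))

  π-valid : ∀ {w} → ValidWord w → ValidT (π w)
  π-valid {[]}    v = []
  π-valid {_ ∷ _} v = v ∷ []

  series-valid : ∀ N {w} → ValidWord w → ValidT (series N w)
  series-valid zero    v = [] ∷ []
  series-valid (suc N) v = AllP.++⁺ ([] ∷ []) (scale-valid (- 1#) (conv-valid π-valid (series-valid N) v))

  -- Reduction of the Hopf algebra axioms to basis words

  eval-ε : ∀ x → ε x ≈ eval εw x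
  eval-ε []      = ≈-refl
  eval-ε (t ∷ x) = +-congˡ (eval-ε x)

  eval-cong-valid : ∀ {f g : Word → 𝕂} {x} → ValidT x → (∀ {w} → ValidWord w → f w ≈ g w) → eval f x ≈ eval g x
  eval-cong-valid vx e = eval-cong-All (All.map e vx)

  eval-η-ε : ∀ {f} x → eval (λ w → eval f (unitT w)) x ≈ eval f (η (ε x))
  eval-η-ε {f} x = begin
    eval (λ w → eval f (unitT w)) x ≈⟨ eval-cong x (λ w → ≈-trans (eval-single f (εw w) []) (*-comm _ _)) ⟩
    eval (λ w → f [] * εw w) x      ≈⟨ eval-*ˡ (f []) x ⟩
    f [] * eval εw x                ≈⟨ ≈-trans (*-comm _ _) (*-congʳ (≈-sym (eval-ε x))) ⟩
    ε x * f []                      ≈⟨ eval-single f (ε x) [] ⟨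
    eval f (η (ε x)) ∎

  eval-convSid : ∀ {f} S x → eval f (convSid S x) ≈ eval (λ w → eval f (conv S basis w)) x
  eval-convSid {f} S x = begin
    eval f (convSid S x)
      ≈⟨ eval-concatMap _ (Δ x) (λ { k (a , b) → ≈-trans (eval-scale k (mulT (S a) (basis b))) (*-congˡ (eval-mulT (S a) (basis b))) }) ⟩
    _ ≈⟨ eval-Δ x ⟩
    _ ≈⟨ eval-cong x (λ w → eval-conv S basis w) ⟨
    eval (λ w → eval f (conv S basis w)) x ∎

  eval-convidS : ∀ {f} S x → eval f (convidS S x) ≈ eval (λ w → eval f (conv basis S w)) x
  eval-convidS {f} S x = begin
    eval f (convidS S x)
      ≈⟨ eval-concatMap _ (Δ x) (λ { k (a , b) → ≈-trans (eval-scale k (mulT (basis a) (S b))) (*-congˡ (eval-mulT (basis a) (S b))) }) ⟩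
    _ ≈⟨ eval-Δ x ⟩
    _ ≈⟨ eval-cong x (λ w → eval-conv basis S w) ⟨
    eval (λ w → eval f (conv basis S w)) x ∎

  mulT-assoc : ∀ x y z → mulT (mulT x y) z ≋ mulT x (mulT y z)
  mulT-assoc x y z f = begin
    eval f (mulT (mulT x y) z) ≈⟨ ≈-trans (eval-mulT (mulT x y) z) (eval-mulT x y) ⟩
    _ ≈⟨ eval-cong x (λ a → eval-cong y λ b → eval-cong z λ c → ≈-reflexive (cong f (++-assoc a b c))) ⟩
    _ ≈⟨ ≈-trans (eval-mulT x (mulT y z)) (eval-cong x λ a → eval-mulT y z) ⟨
    eval f (mulT x (mulT y z)) ∎

  Δ-mulT : ∀ x y → Δ (mulT x y) ≋ mulT2 (Δ x) (Δ y)
  Δ-mulT x y f = begin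
    eval f (Δ (mulT x y)) ≈⟨ ≈-trans (eval-Δ (mulT x y)) (eval-mulT x y) ⟩
    _ ≈⟨ eval-cong x (λ a → ≈-trans (eval-cong y λ b → E-++ a b) (eval-swap y (Δw a))) ⟩
    eval (λ a → E a (λ t → eval (λ b → E b (λ t′ → f (t · t′))) y)) x
      ≈⟨ eval-cong x (λ a → eval-cong (Δw a) λ t → eval-Δ y) ⟨
    _ ≈⟨ eval-Δ x ⟨
    _ ≈⟨ eval-mulT2 (Δ x) (Δ y) ⟨
    eval f (mulT2 (Δ x) (Δ y)) ∎

  ε-mulT : ∀ x y → ε (mulT x y) ≈ ε x * ε y
  ε-mulT x y = begin
    ε (mulT x y) ≈⟨ ≈-trans (eval-ε (mulT x y)) (eval-mulT x y) ⟩
    _ ≈⟨ eval-cong x (λ a → ≈-trans (eval-cong y λ b → εw-++ a b)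
           (≈-trans (eval-*ˡ (εw a) y) (*-comm _ _))) ⟩
    eval (λ a → eval εw y * εw a) x ≈⟨ eval-*ˡ (eval εw y) x ⟩
    eval εw y * eval εw x ≈⟨ *-comm _ _ ⟩
    eval εw x * eval εw y ≈⟨ *-cong (eval-ε x) (eval-ε y) ⟨
    ε x * ε y ∎

  eval-ε⊗id : ∀ {f} y → eval f (ε⊗id y) ≈ eval (λ { (a , b) → εw a * f b }) y
  eval-ε⊗id []                  = ≈-refl
  eval-ε⊗id ((k , (a , b)) ∷ y) = +-cong (*-assoc _ _ _) (eval-ε⊗id y)

  eval-id⊗ε : ∀ {f} y → eval f (id⊗ε y) ≈ eval (λ { (a , b) → εw b * f a }) y
  eval-id⊗ε []                  = ≈-refl
  eval-id⊗ε ((k , (a , b)) ∷ y) = +-cong (*-assoc _ _ _) (eval-id⊗ε y)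

  coassocT : ∀ x → ValidT x → Δ⊗id (Δ x) ≋ id⊗Δ (Δ x)
  coassocT x vx f = begin
    eval f (Δ⊗id (Δ x))
      ≈⟨ eval-concatMap _ (Δ x) (λ { k (a , b) → eval-map (λ { (a₁ , a₂) → a₁ , a₂ , b }) k (Δw a) λ _ _ → refl }) ⟩
    _ ≈⟨ eval-Δ x ⟩
    eval (λ w → ΔΔˡ w λ a b c → f (a , b , c)) x ≈⟨ eval-cong-valid vx (λ v → coassoc-word v λ a b c → f (a , b , c)) ⟩
    eval (λ w → ΔΔʳ w λ a b c → f (a , b , c)) x ≈⟨ eval-Δ x ⟨
    _ ≈⟨ eval-concatMap _ (Δ x) (λ { k (a , b) → eval-map (λ { (b₁ , b₂) → a , b₁ , b₂ }) k (Δw b) λ _ _ → refl }) ⟨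
    eval f (id⊗Δ (Δ x)) ∎

  isConnectedGradedHopfAlgebra : IsConnectedGradedHopfAlgebra
  isConnectedGradedHopfAlgebra = record
    { mul-closed = mulT-valid
    ; mul-assoc = λ x y z _ _ _ → ≋⇒coeff _≟W_ (mulT (mulT x y) z) (mulT x (mulT y z)) (mulT-assoc x y z)
    ; mul-unitˡ = λ x _ → ≋⇒coeff _≟W_ (mulT oneT x) x λ f → ≈-trans (eval-mulT oneT x) (eval-basis (λ a → eval (λ b → f (a ++ b)) x) [])
    ; mul-unitʳ = λ x _ → ≋⇒coeff _≟W_ (mulT x oneT) x λ f → ≈-trans (eval-mulT x oneT)
        (eval-cong x λ a → ≈-trans (eval-basis (λ b → f (a ++ b)) []) (≈-reflexive (cong f (++-identityʳ a))))
    ; Δ-closed = λ x vx → All-concatMap (All.map (λ v →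
        AllP.map⁺ (All.map (λ g → validˡ g , validʳ g) (good-Δw v))) vx)
    ; coassoc = λ x vx → ≋⇒coeff _≟W3_ (Δ⊗id (Δ x)) (id⊗Δ (Δ x)) (coassocT x vx)
    ; counitˡ = λ x vx → ≋⇒coeff _≟W_ (ε⊗id (Δ x)) x λ f → ≈-trans (eval-ε⊗id (Δ x))
        (≈-trans (eval-Δ x) (eval-cong-valid vx λ v → counitˡ-word v f))
    ; counitʳ = λ x vx → ≋⇒coeff _≟W_ (id⊗ε (Δ x)) x λ f → ≈-trans (eval-id⊗ε (Δ x))
        (≈-trans (eval-Δ x) (eval-cong-valid vx λ v → counitʳ-word v f))
    ; Δ-mul = λ x y _ _ → ≋⇒coeff _≟W2_ (Δ (mulT x y)) (mulT2 (Δ x) (Δ y)) (Δ-mulT x y)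
    ; Δ-unit = ≋⇒coeff _≟W2_ (Δ oneT) oneT2 λ f → ≈-trans (eval-Δ {f} oneT) (eval-basis (λ w → E w f) [])
    ; ε-mul = λ x y _ _ → ε-mulT x y
    ; ε-unit = ≈-trans (eval-ε oneT) (eval-basis εw [])
    ; antipode = antipodeT , (λ w v → series-valid (degW w) v)
        , (λ x vx → ≋⇒coeff _≟W_ (convSid antipodeT x) (η (ε x)) λ f → ≈-trans (eval-convSid antipodeT x)
            (≈-trans (eval-cong-valid vx λ v → antipodeˡ v f) (eval-η-ε {f} x)))
        , (λ x vx → ≋⇒coeff _≟W_ (convidS antipodeT x) (η (ε x)) λ f → ≈-trans (eval-convidS antipodeT x)
            (≈-trans (eval-cong-valid vx λ v → antipodeʳ v f) (eval-η-ε {f} x)))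
    ; deg-mul = degW-++
    ; deg-Δ = λ w v → All.map degree (good-Δw v)
    ; connected = λ { [] v d → refl ; (L ∷ w) v d → ⊥-elim (ℕP.n≮0 (subst (1 ≤_) d (valid-nonzero v))) }
    }

  -- Witnesses of noncommutativity and noncocommutativity

  one-block-NC : ∀ n → IsNC (range (suc n) ∷ [])
  one-block-NC n = suc n , record
    { n≥1 = s≤s z≤n ; nonemptyBlocks = (λ ()) ∷ [] ; sortedBlocks = range-sorted (suc n) ∷ []
    ; orderedBlocks = [] ∷ [] ; covers = Perm.↭-reflexive (++-identityʳ _)
    ; nonCrossing = λ { zero zero i≢j → ⊥-elim (i≢j refl) } }

  nested-pair : Partition
  nested-pair = (1 ∷ 3 ∷ []) ∷ (2 ∷ []) ∷ []

  nested-pair-NC : IsNC nested-pair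
  nested-pair-NC = 3 , record
    { n≥1 = s≤s z≤n
    ; nonemptyBlocks = (λ ()) ∷ (λ ()) ∷ []
    ; sortedBlocks = ((s≤s (s≤s z≤n) ∷ []) ∷ [] ∷ []) ∷ ([] ∷ []) ∷ []
    ; orderedBlocks = (s≤s (s≤s z≤n) ∷ []) ∷ [] ∷ []
    ; covers = Perm.prep 1 (Perm.swap 3 2 Perm.refl)
    ; nonCrossing = λ
        { zero zero i≢j → ⊥-elim (i≢j refl)
        ; (suc zero) (suc zero) i≢j → ⊥-elim (i≢j refl)
        -- A crossing would require two different points in the block of 2 alone.
        ; zero (suc zero) _ _ _ _ _ _ _ (here refl) (here refl) (_ , l , l′) → ℕP.<-asym l l′
        ; (suc zero) zero _ _ _ _ _ (here refl) (here refl) _ _ (l , l′ , _) → ℕP.<-asym l l′ } }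

  -- For two different letters the two products are different basis words: `L₁ ∷ L₂ ∷ []` has
  -- coefficient 1 in one and 0 in the other.
  nonCommutative : ¬ (1# ≈ 0#) → NonCommutative
  nonCommutative 1≉0 = basis (L₁ ∷ []) , basis (L₂ ∷ []) ,
    ((one-block-NC 0 ∷ []) ∷ []) , ((one-block-NC 1 ∷ []) ∷ []) ,
    λ e → 1≉0 (≈-trans (≈-sym (≈-trans (+-identityʳ _) (*-identityˡ 1#))) (e (L₁ ∷ L₂ ∷ [])))
    where
    L₁ L₂ : Partition
    L₁ = range 1 ∷ []
    L₂ = range 2 ∷ []

  -- Δ contains (1 2) ⊗ (1), from Q = {13} and U = {2}; the opposite splitting is not admissible, so (1) ⊗ (1 2) does not occur.
  nonCocommutative : ¬ (1# ≈ 0#) → NonCocommutative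
  nonCocommutative 1≉0 = basis (nested-pair ∷ []) , ((nested-pair-NC ∷ []) ∷ []) ,
    λ e → 1≉0 (≈-trans (≈-sym one) (e ((((1 ∷ 2 ∷ []) ∷ []) ∷ []) , (((1 ∷ []) ∷ []) ∷ []))))
    where
    -- The factors are the coefficient of the basis vector, that of the term of `ΔL` and that of the
    -- coproduct of the empty tail.
    one : 1# * (1# * 1#) + 0# ≈ 1#
    one = ≈-trans (+-identityʳ _) (≈-trans (*-identityˡ _) (*-identityˡ 1#))

mainTheorem1 : ∀ {c ℓ} (K : CommutativeRing c ℓ) → IsFieldChar0 K →
    Lin.IsConnectedGradedHopfAlgebra K × Lin.NonCommutative K × Lin.NonCocommutative K
mainTheorem1 K F = isConnectedGradedHopfAlgebra , nonCommutative 1≉0 , nonCocommutative 1≉0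
  where
  open Linear K
  open IsFieldChar0 F
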